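{- Let $n$ be a positive integer, and let $c:E(K_{6n})\to [3]$ be an edge-coloring (not necessarily proper) of the complete graph $K_{6n}$ on $6n$ vertices such that, for every $i\in[3]$, there are equally many edges $e$ with $c(e)=i$. Then there is a perfect matching $M$ of $K_{6n}$ with $$f(M)=\sum_{i=1}^3\Big||c^{ -1}(i)\cap M|-n\Big|\leq 2.$$
   Context: $[3]=\{1,2,3\}$. For a perfect matching $M$, $|c^{ -1}(i)\cap M|$ is the number of edges of $M$ with color $i$. -}

module Defs where

open import Data.Nat using (ℕ; _<_; _+_; ∣_-_∣)
open import Data.Nat.Properties using (_<?_)
open import Data.Fin using (Fin; toℕ)
open import Data.Fin.Properties using (_≟_)
open import Data.List using (List; length; filter; allFin; cartesianProduct)
open import Data.Product using (_×_; _,_; proj₁; proj₂)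
open import Relation.Nullary using (¬_)
open import Relation.Nullary.Decidable using (_×-dec_)
open import Relation.Binary.PropositionalEquality using (_≡_; _≢_)

-- An edge-colouring of the complete graph K_N with colours Fin 3 (= [3]):
-- a function on ordered pairs that is symmetric, so it is really a function
-- on the unordered edges {i,j}, i ≠ j (the values on the diagonal are irrelevant).
record EdgeColouring (N : ℕ) : Set where
  field
    col : Fin N → Fin N → Fin 3
    sym : ∀ i j → col i j ≡ col j i
open EdgeColouring public

colourClassSize : ∀ {N} → EdgeColouring N → Fin 3 → ℕ
colourClassSize {N} c k =
  length (filter (λ p → (toℕ (proj₁ p) <? toℕ (proj₂ p)) ×-dec (col c (proj₁ p) (proj₂ p) ≟ k))
                 (cartesianProduct (allFin N) (allFin N)))

-- A perfect matching of K_N, given as its partner map: a fixed-point-free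
-- involution on the vertex set. The edges of the matching are {i, partner i}.
record PerfectMatching (N : ℕ) : Set where
  field
    partner : Fin N → Fin N
    involutive : ∀ i → partner (partner i) ≡ i
    noFixed : ∀ i → partner i ≢ i
open PerfectMatching public

-- |c⁻¹(k) ∩ M| : number of edges {i, partner i} of M (counted once, via
-- toℕ i < toℕ (partner i)) with colour k.
matchedOfColour : ∀ {N} → EdgeColouring N → PerfectMatching N → Fin 3 → ℕ
matchedOfColour {N} c M k =
  length (filter (λ i → (toℕ i <? toℕ (partner M i)) ×-dec (col c i (partner M i) ≟ k))
                 (allFin N))

f : ∀ {N} → ℕ → EdgeColouring N → PerfectMatching N → ℕ
f n c M = ∣ matchedOfColour c M Fin.zero - n ∣
        + ∣ matchedOfColour c M (Fin.suc Fin.zero) - n ∣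
        + ∣ matchedOfColour c M (Fin.suc (Fin.suc Fin.zero)) - n ∣
  where import Data.Fin as Fin

{-# OPTIONS --safe #-}

-- Let x and y be the gaps between consecutive colour counts of a matching M, sorted decreasingly.
-- The counts add up to 3n, so f(M) ≤ 2 once x + y ≤ 2, and it suffices to lower x + y while it is
-- at least 3. A switch replaces two edges uu′, xx′ of M by ux, u′x′ and adds one of 19 vectors to
-- (x , y). Every edge outside M is created by exactly one switch and the colour classes are equally
-- large, so, over all ordered pairs of vertices (u , x) of K_N, these vectors add up to
-- -4(N - 1)(x , y). If no single switch lowers x + y, few vectors remain possible, and evaluating
-- suitable linear forms on the total yields two families of at least 4(N - 1) pairs each such that
-- a switch from one followed by a disjoint switch from the other lowers x + y. For N ≥ 11 two
-- families of this size have disjoint members. This leaves n = 1 with a monochromatic M, where a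
-- single switch suffices.
module Submission where

open import Defs renaming (sym to col-sym)
open import Data.Nat as ℕ using (ℕ; zero; suc; s≤s; z≤n)
import Data.Nat.Properties as ℕP
import Data.Nat.Tactic.RingSolver as ℕSolver
open import Data.Nat.Divisibility using (_∣_; _∣?_; m∣m*n; ∣m+n∣m⇒∣n)
import Data.Integer as ℤ
import Data.Integer.Properties as ℤP
open import Data.Integer.Tactic.RingSolver using (solve-∀)
open import Algebra.Properties.Semiring.Sum ℤP.+-*-semiring
import Algebra.Properties.CommutativeMonoid.Sum ℕP.+-0-commutativeMonoid as ℕSum
open import Data.Bool using (true; false; if_then_else_)
open import Data.Fin as Fin using (Fin; toℕ)
open import Data.Fin.Patterns using (0F; 1F; 2F)
open import Data.Fin.Properties using (_≟_; any?; all?; toℕ-injective; suc-injective)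
open import Data.Fin.Permutation as Perm using (Permutation; _⟨$⟩ʳ_; _⟨$⟩ˡ_; inverseʳ; inverseˡ)
import Data.Fin.Permutation.Components as PC
open import Data.List using (List; []; _∷_; length; _++_; map; filter; tabulate; cartesianProduct)
import Data.List.Properties as ListP
open import Data.List.Membership.Propositional using (_∈_)
open import Data.List.Membership.Propositional.Properties using (∈-cartesianProduct⁺; ∈-++⁺ˡ; ∈-++⁺ʳ)
open import Data.List.Relation.Unary.Any using (here; there)
open import Data.Product using (_×_; _,_; proj₁; proj₂; Σ; ∃; ∃₂)
open import Data.Sum as Sum using (_⊎_; inj₁; inj₂; [_,_]′)
open import Data.Empty using (⊥; ⊥-elim)
open import Function using (_∘_; id)
open import Relation.Nullary using (¬_; Dec; yes; no; does)
open import Relation.Nullary.Decidable using (_×-dec_; _⊎-dec_; _→-dec_; ¬?; map′; from-yes; from-no)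
open import Relation.Binary.PropositionalEquality

-- Single switches can get stuck: at gaps `(3 , 0)` neither of the steps `(0 , -3)` and `(-3 , 3)`
-- lowers `x + y`, although their sum `(-3 , 0)` does. Two steps measured in the same matching may
-- be added only if the second switch replaces edges that the first leaves alone, so disjointness is
-- the real difficulty. The count is tight. All switches that involve one fixed matching edge form a
-- family without disjoint members, and as ordered pairs on two distinct matching edges they number
-- `4(N - 2)`. Averaging yields `4(N - 1)`, just enough to exclude such a star. The other ways for
-- two families to avoid disjoint members confine one of them to at most 36 pairs, which
-- `4(N - 1) ≥ 40` excludes. The counts add up to `3n`, so the two gaps are congruent modulo 3. This
-- is why `x + y ≤ 2` already gives `f(M) ≤ 2`, and why three lower corners `(3 , 0)`, `(0 , 3)`,
-- `(2 , 2)` cover all remaining gaps.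

module _ where

  open import Data.Integer using (ℤ; +_; -_; _+_; _-_; _*_; _≤_; _<_; 0ℤ; 1ℤ; -1ℤ; +≤+; +<+; _<?_; _≤?_)

  -- Indicators and finite sums of integers

  ≤-via : ∀ {a b} c → 0ℤ ≤ c → b ≡ a + c → a ≤ b
  ≤-via {a} c 0≤c refl = subst (_≤ a + c) (ℤP.+-identityʳ a) (ℤP.+-monoʳ-≤ a 0≤c)

  <-via : ∀ {a b} c → 0ℤ < c → b ≡ a + c → a < b
  <-via {a} c 0<c refl = subst (_< a + c) (ℤP.+-identityʳ a) (ℤP.+-monoʳ-< a 0<c)

  ⟦_⟧ : ∀ {p} {P : Set p} → Dec P → ℤ
  ⟦ P? ⟧ = if does P? then 1ℤ else 0ℤ

  ⟦⟧-yes : ∀ {p} {P : Set p} (P? : Dec P) → P → ⟦ P? ⟧ ≡ 1ℤ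
  ⟦⟧-yes (yes _) _ = refl
  ⟦⟧-yes (no ¬p) p = ⊥-elim (¬p p)

  ⟦⟧-no : ∀ {p} {P : Set p} (P? : Dec P) → ¬ P → ⟦ P? ⟧ ≡ 0ℤ
  ⟦⟧-no (yes p) ¬p = ⊥-elim (¬p p)
  ⟦⟧-no (no _)  _  = refl

  ⟦⟧-cong : ∀ {p q} {P : Set p} {Q : Set q} (P? : Dec P) (Q? : Dec Q) →
            (P → Q) → (Q → P) → ⟦ P? ⟧ ≡ ⟦ Q? ⟧
  ⟦⟧-cong (yes p) Q? f g = sym (⟦⟧-yes Q? (f p))
  ⟦⟧-cong (no ¬p) Q? f g = sym (⟦⟧-no Q? (¬p ∘ g))

  ⟦⟧*⟦⟧≥0 : ∀ {p q} {P : Set p} {Q : Set q} (P? : Dec P) (Q? : Dec Q) → 0ℤ ≤ ⟦ P? ⟧ * ⟦ Q? ⟧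
  ⟦⟧*⟦⟧≥0 (yes _) (yes _) = +≤+ z≤n
  ⟦⟧*⟦⟧≥0 (yes _) (no _)  = +≤+ z≤n
  ⟦⟧*⟦⟧≥0 (no _)  (yes _) = +≤+ z≤n
  ⟦⟧*⟦⟧≥0 (no _)  (no _)  = +≤+ z≤n

  sum-mono : ∀ {n} {f g : Fin n → ℤ} → (∀ i → f i ≤ g i) → sum f ≤ sum g
  sum-mono {zero}  h = ℤP.≤-refl
  sum-mono {suc n} h = ℤP.+-mono-≤ (h Fin.zero) (sum-mono (h ∘ Fin.suc))

  sum-const : ∀ n c → sum {n} (λ _ → c) ≡ + n * c
  sum-const zero    c = refl
  sum-const (suc n) c = trans (cong (_+_ c) (sum-const n c)) (sym (ℤP.suc-* (+ n) c))

  sum-zero : ∀ n → sum {n} (λ _ → 0ℤ) ≡ 0ℤ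
  sum-zero n = trans (sum-const n 0ℤ) (ℤP.*-zeroʳ (+ n))

  sum-scale : ∀ {n} c (f : Fin n → ℤ) → sum (λ i → c * f i) ≡ c * sum f
  sum-scale c f = sym (*-distribˡ-sum c f)

  sum-at : ∀ {n} (a : Fin n) → sum (λ t → ⟦ t ≟ a ⟧) ≡ 1ℤ
  sum-at {suc n} Fin.zero =
    cong (_+_ 1ℤ) (trans (sum-cong-≗ {n} λ i → ⟦⟧-no (Fin.suc i ≟ Fin.zero) λ ()) (sum-zero n))
  sum-at {suc n} (Fin.suc a) =
    trans (ℤP.+-identityˡ _)
          (trans (sum-cong-≗ {n} λ i → ⟦⟧-cong (Fin.suc i ≟ Fin.suc a) (i ≟ a) (λ { refl → refl }) (cong Fin.suc))
                 (sum-at a))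

  sum-select : ∀ {n} (a : Fin n) (f : Fin n → ℤ) → sum (λ t → ⟦ t ≟ a ⟧ * f t) ≡ f a
  sum-select {n} a f = begin
    sum (λ t → ⟦ t ≟ a ⟧ * f t) ≡⟨ sum-cong-≗ pointwise ⟩
    sum (λ t → f a * ⟦ t ≟ a ⟧) ≡⟨ sum-scale (f a) (λ t → ⟦ t ≟ a ⟧) ⟩
    f a * sum (λ t → ⟦ t ≟ a ⟧) ≡⟨ cong (_*_ (f a)) (sum-at a) ⟩
    f a * 1ℤ                    ≡⟨ ℤP.*-identityʳ (f a) ⟩
    f a                         ∎
    where
    open ≡-Reasoning
    pointwise : ∀ t → ⟦ t ≟ a ⟧ * f t ≡ f a * ⟦ t ≟ a ⟧
    pointwise t with t ≟ a
    ... | yes refl = ℤP.*-comm 1ℤ (f a)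
    ... | no _ = ℤP.*-comm 0ℤ (f a)

  -- Meant for a switch, which affects only the four endpoints of the two replaced edges.
  sum-change₄ : ∀ {n} (f g : Fin n → ℤ) (a b c d : Fin n) → a ≢ b → a ≢ c → a ≢ d → b ≢ c → b ≢ d → c ≢ d →
                (∀ t → t ≢ a → t ≢ b → t ≢ c → t ≢ d → f t ≡ g t) →
                sum f ≡ sum g + ((f a - g a) + ((f b - g b) + ((f c - g c) + (f d - g d))))
  sum-change₄ f g a b c d a≢b a≢c a≢d b≢c b≢d c≢d same = begin
    sum f
      ≡⟨ sum-cong-≗ pointwise ⟩
    sum (λ t → g t + (⟦ t ≟ a ⟧ * δ t + (⟦ t ≟ b ⟧ * δ t + (⟦ t ≟ c ⟧ * δ t + ⟦ t ≟ d ⟧ * δ t))))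
      ≡⟨ trans (∑-distrib-+ g _) (cong (_+_ (sum g))
           (trans (∑-distrib-+ (λ t → ⟦ t ≟ a ⟧ * δ t) _) (cong₂ _+_ (sum-select a δ)
           (trans (∑-distrib-+ (λ t → ⟦ t ≟ b ⟧ * δ t) _) (cong₂ _+_ (sum-select b δ)
           (trans (∑-distrib-+ (λ t → ⟦ t ≟ c ⟧ * δ t) _) (cong₂ _+_ (sum-select c δ) (sum-select d δ)))))))) ⟩
    sum g + (δ a + (δ b + (δ c + δ d))) ∎
    where
    open ≡-Reasoning
    δ : Fin _ → ℤ
    δ t = f t - g t
    in₁ : ∀ x y → x ≡ y + (1ℤ * (x - y) + (0ℤ * (x - y) + (0ℤ * (x - y) + 0ℤ * (x - y))))
    in₁ = solve-∀
    in₂ : ∀ x y → x ≡ y + (0ℤ * (x - y) + (1ℤ * (x - y) + (0ℤ * (x - y) + 0ℤ * (x - y))))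
    in₂ = solve-∀
    in₃ : ∀ x y → x ≡ y + (0ℤ * (x - y) + (0ℤ * (x - y) + (1ℤ * (x - y) + 0ℤ * (x - y))))
    in₃ = solve-∀
    in₄ : ∀ x y → x ≡ y + (0ℤ * (x - y) + (0ℤ * (x - y) + (0ℤ * (x - y) + 1ℤ * (x - y))))
    in₄ = solve-∀
    out : ∀ x y → y ≡ y + (0ℤ * (x - y) + (0ℤ * (x - y) + (0ℤ * (x - y) + 0ℤ * (x - y))))
    out = solve-∀
    pointwise : ∀ t → f t ≡ g t + (⟦ t ≟ a ⟧ * δ t + (⟦ t ≟ b ⟧ * δ t + (⟦ t ≟ c ⟧ * δ t + ⟦ t ≟ d ⟧ * δ t)))
    pointwise t with t ≟ a | t ≟ b | t ≟ c | t ≟ d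
    ... | yes refl | yes e    | _        | _        = ⊥-elim (a≢b e)
    ... | yes refl | no _     | yes e    | _        = ⊥-elim (a≢c e)
    ... | yes refl | no _     | no _     | yes e    = ⊥-elim (a≢d e)
    ... | no _     | yes refl | yes e    | _        = ⊥-elim (b≢c e)
    ... | no _     | yes refl | no _     | yes e    = ⊥-elim (b≢d e)
    ... | no _     | no _     | yes refl | yes e    = ⊥-elim (c≢d e)
    ... | yes refl | no _     | no _     | no _     = in₁ (f t) (g t)
    ... | no _     | yes refl | no _     | no _     = in₂ (f t) (g t)
    ... | no _     | no _     | yes refl | no _     = in₃ (f t) (g t)
    ... | no _     | no _     | no _     | yes refl = in₄ (f t) (g t)
    ... | no ta    | no tb    | no tc    | no td    =
      trans (same t ta tb tc td) (out (f t) (g t))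

  ≟-sym : ∀ {n} (a b : Fin n) → ⟦ a ≟ b ⟧ ≡ ⟦ b ≟ a ⟧
  ≟-sym a b = ⟦⟧-cong (a ≟ b) (b ≟ a) sym sym

  expand-at : ∀ {n} (w : Fin n → ℤ) a → w a ≡ sum (λ k → w k * ⟦ a ≟ k ⟧)
  expand-at w a = sym (trans
    (sum-cong-≗ λ k → trans (ℤP.*-comm (w k) ⟦ a ≟ k ⟧) (cong (_* w k) (≟-sym a k)))
    (sum-select a w))

  -- Sums and counts over ordered pairs

  sum₂ : ∀ {m n} → (Fin m → Fin n → ℤ) → ℤ
  sum₂ f = sum λ u → sum (f u)

  module _ {m n : ℕ} where

    sum₂-cong : {f g : Fin m → Fin n → ℤ} → (∀ u x → f u x ≡ g u x) → sum₂ f ≡ sum₂ g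
    sum₂-cong h = sum-cong-≗ λ u → sum-cong-≗ (h u)

    sum₂-mono : {f g : Fin m → Fin n → ℤ} → (∀ u x → f u x ≤ g u x) → sum₂ f ≤ sum₂ g
    sum₂-mono h = sum-mono λ u → sum-mono (h u)

    sum₂-+ : (f g : Fin m → Fin n → ℤ) → sum₂ (λ u x → f u x + g u x) ≡ sum₂ f + sum₂ g
    sum₂-+ f g = trans (sum-cong-≗ λ u → ∑-distrib-+ (f u) (g u)) (∑-distrib-+ (λ u → sum (f u)) _)

    sum₂-scale : ∀ c (f : Fin m → Fin n → ℤ) → sum₂ (λ u x → c * f u x) ≡ c * sum₂ f
    sum₂-scale c f = trans (sum-cong-≗ λ u → sum-scale c (f u)) (sum-scale c (λ u → sum (f u)))

    sum₂-zero : sum₂ {m} {n} (λ _ _ → 0ℤ) ≡ 0ℤ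
    sum₂-zero = trans (sum-cong-≗ {m} λ _ → sum-zero n) (sum-zero m)

    sum₂-product : (f : Fin m → ℤ) (g : Fin n → ℤ) → sum₂ (λ u x → f u * g x) ≡ sum f * sum g
    sum₂-product f g = trans (sum-cong-≗ λ u → sum-scale (f u) g) (sym (*-distribʳ-sum (sum g) f))

    sum₂-left : (f : Fin m → ℤ) → sum₂ {m} {n} (λ u _ → f u) ≡ + n * sum f
    sum₂-left f = trans (sum-cong-≗ {m} λ u → sum-const n (f u)) (sum-scale (+ n) f)

    sum₂-right : (g : Fin n → ℤ) → sum₂ {m} {n} (λ _ x → g x) ≡ + m * sum g
    sum₂-right g = sum-const m (sum g)

    multiplicity : List (Fin m × Fin n) → Fin m → Fin n → ℤ
    multiplicity []            u x = 0ℤ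
    multiplicity ((v , y) ∷ L) u x = ⟦ u ≟ v ⟧ * ⟦ x ≟ y ⟧ + multiplicity L u x

    multiplicity≥0 : ∀ L u x → 0ℤ ≤ multiplicity L u x
    multiplicity≥0 []            u x = ℤP.≤-refl
    multiplicity≥0 ((v , y) ∷ L) u x = ℤP.+-mono-≤ (⟦⟧*⟦⟧≥0 (u ≟ v) (x ≟ y)) (multiplicity≥0 L u x)

    multiplicity≥1 : ∀ {L u x} → (u , x) ∈ L → 1ℤ ≤ multiplicity L u x
    multiplicity≥1 {(v , y) ∷ L} {u} {x} (here refl)
      rewrite ⟦⟧-yes (u ≟ v) refl | ⟦⟧-yes (x ≟ y) refl = ℤP.+-mono-≤ (ℤP.≤-refl {1ℤ}) (multiplicity≥0 L u x)
    multiplicity≥1 {(v , y) ∷ L} {u} {x} (there h) =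
      ℤP.+-mono-≤ (⟦⟧*⟦⟧≥0 (u ≟ v) (x ≟ y)) (multiplicity≥1 h)

    sum₂-multiplicity : ∀ L → sum₂ (multiplicity L) ≡ + length L
    sum₂-multiplicity []            = sum₂-zero
    sum₂-multiplicity ((v , y) ∷ L) =
      trans (sum₂-+ (λ u x → ⟦ u ≟ v ⟧ * ⟦ x ≟ y ⟧) (multiplicity L))
            (cong₂ _+_ (trans (sum₂-product (λ u → ⟦ u ≟ v ⟧) (λ x → ⟦ x ≟ y ⟧)) (cong₂ _*_ (sum-at v) (sum-at y)))
                       (sum₂-multiplicity L))

    -- Repetitions in `L` do no harm: `multiplicity L` dominates the indicator pointwise and sums to
    -- the length.
    count≤length : {P : Fin m → Fin n → Set} (P? : ∀ u x → Dec (P u x)) (L : List (Fin m × Fin n)) →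
                   (∀ {u x} → P u x → (u , x) ∈ L) → sum₂ (λ u x → ⟦ P? u x ⟧) ≤ + length L
    count≤length P? L P⊆L = ℤP.≤-trans (sum₂-mono pointwise) (ℤP.≤-reflexive (sum₂-multiplicity L))
      where
      pointwise : ∀ u x → ⟦ P? u x ⟧ ≤ multiplicity L u x
      pointwise u x with P? u x
      ... | yes p = multiplicity≥1 (P⊆L p)
      ... | no _  = multiplicity≥0 L u x

  -- Disjoint members of two large families of switches

  -- κ picks an end of every matching edge, so an ordered pair (u , x) with κ u ≢ κ x
  -- stands for a choice of two matching edges.
  module Disjoint {N : ℕ} (partner κ : Fin N → Fin N)
    (κ-fibre : ∀ {u s} → κ u ≡ s → u ≡ s ⊎ u ≡ partner s)
    (κ-fibre-size : ∀ t → sum (λ u → ⟦ κ u ≟ κ t ⟧) ≡ + 2)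
    (N≥11 : 11 ℕ.≤ N)
    where

    count : {A : Fin N → Fin N → Set} → (∀ u x → Dec (A u x)) → ℤ
    count A? = sum₂ λ u x → ⟦ A? u x ⟧

    record LargeFamily (A : Fin N → Fin N → Set) : Set where
      field
        member? : ∀ u x → Dec (A u x)
        proper  : ∀ {u x} → A u x → κ u ≢ κ x
        large   : + 4 * (+ N - 1ℤ) ≤ count member?

    -- The arguments of Meet and Joined are values of κ.
    Meet : (s t s′ t′ : Fin N) → Set
    Meet s t s′ t′ = (s ≡ s′ ⊎ s ≡ t′) ⊎ (t ≡ s′ ⊎ t ≡ t′)

    Meet? : ∀ s t s′ t′ → Dec (Meet s t s′ t′)
    Meet? s t s′ t′ = ((s ≟ s′) ⊎-dec (s ≟ t′)) ⊎-dec ((t ≟ s′) ⊎-dec (t ≟ t′))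

    Meet-sym : ∀ {s t s′ t′} → Meet s t s′ t′ → Meet s′ t′ s t
    Meet-sym (inj₁ (inj₁ e)) = inj₁ (inj₁ (sym e))
    Meet-sym (inj₁ (inj₂ e)) = inj₂ (inj₁ (sym e))
    Meet-sym (inj₂ (inj₁ e)) = inj₁ (inj₂ (sym e))
    Meet-sym (inj₂ (inj₂ e)) = inj₂ (inj₂ (sym e))

    swap-meet : ∀ {s t s′ t′} → Meet s t s′ t′ → Meet t s s′ t′
    swap-meet (inj₁ m) = inj₂ m
    swap-meet (inj₂ m) = inj₁ m

    Joined : (Fin N → Fin N → Set) → Fin N → Fin N → Set
    Joined A s t = ∃₂ λ u x → A u x × ((κ u ≡ s × κ x ≡ t) ⊎ (κ u ≡ t × κ x ≡ s))

    Joined-sym : ∀ {A s t} → Joined A s t → Joined A t s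
    Joined-sym (u , x , a , inj₁ e) = u , x , a , inj₂ e
    Joined-sym (u , x , a , inj₂ e) = u , x , a , inj₁ e

    joined : ∀ {A : Fin N → Fin N → Set} {u x} → A u x → Joined A (κ u) (κ x)
    joined {u = u} {x} a = u , x , a , inj₁ (refl , refl)

    CrossMeeting : (A B : Fin N → Fin N → Set) → Set
    CrossMeeting A B = ∀ {s t s′ t′} → Joined A s t → Joined B s′ t′ → Meet s t s′ t′

    cross-meeting : ∀ {A B} → (∀ {u x v y} → A u x → B v y → Meet (κ u) (κ x) (κ v) (κ y)) → CrossMeeting A B
    cross-meeting m (_ , _ , a , inj₁ (refl , refl)) (_ , _ , b , inj₁ (refl , refl)) = m a b
    cross-meeting m (_ , _ , a , inj₂ (refl , refl)) (_ , _ , b , inj₁ (refl , refl)) = swap-meet (m a b)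
    cross-meeting m (_ , _ , a , inj₁ (refl , refl)) (_ , _ , b , inj₂ (refl , refl)) =
      Meet-sym (swap-meet (Meet-sym (m a b)))
    cross-meeting m (_ , _ , a , inj₂ (refl , refl)) (_ , _ , b , inj₂ (refl , refl)) =
      swap-meet (Meet-sym (swap-meet (Meet-sym (m a b))))

    -- `N ≥ 11` makes a large family have at least 40 members. The lists to which this is applied
    -- have 36 and 32 entries.
    count-small : ∀ {A} → LargeFamily A → (L : List (Fin N × Fin N)) → length L ℕ.≤ 39 →
                  ¬ (∀ {u x} → A u x → (u , x) ∈ L)
    count-small F L len A⊆L = ℤP.<⇒≱ 39<4N-4 4N-4≤39
      where
      open LargeFamily F
      4N-4≤39 : + 4 * (+ N - 1ℤ) ≤ + 39
      4N-4≤39 = ℤP.≤-trans large (ℤP.≤-trans (count≤length member? L A⊆L) (+≤+ len))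
      39<4N-4 : + 39 < + 4 * (+ N - 1ℤ)
      39<4N-4 = ℤP.<-≤-trans (+<+ ℕP.≤-refl)
        (≤-via (+ 4 * (+ N - + 11)) (ℤP.*-monoˡ-≤-nonNeg (+ 4) (ℤP.i≤j⇒0≤j-i (+≤+ N≥11))) (eq (+ N)))
        where
        eq : ∀ n → + 4 * (n - 1ℤ) ≡ + 40 + + 4 * (n - + 11)
        eq = solve-∀

    module _ {A : Fin N → Fin N → Set} (F : LargeFamily A) where
      open LargeFamily F

      joined-proper : ∀ {s t} → Joined A s t → s ≢ t
      joined-proper (u , x , a , inj₁ (refl , refl)) = proper a
      joined-proper (u , x , a , inj₂ (refl , refl)) = proper a ∘ sym

      -- The proper pairs meeting a given class number at most 2N + 2N - 8 < 4(N - 1).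
      avoid-class : ∀ t → ∃₂ λ u x → A u x × κ u ≢ κ t × κ x ≢ κ t
      avoid-class t with any? (λ u → any? λ x → member? u x ×-dec ¬? (κ u ≟ κ t) ×-dec ¬? (κ x ≟ κ t))
      ... | yes found = found
      ... | no none = ⊥-elim (absurd (ℤP.i≤j⇒0≤j-i (ℤP.≤-trans (ℤP.+-monoˡ-≤ (+ 8) large) bound)))
        where
        T : Fin N → ℤ
        T u = ⟦ κ u ≟ κ t ⟧
        eq : ∀ n → n * + 2 + n * + 2 - (+ 4 * (n - 1ℤ) + + 8) ≡ - (+ 4)
        eq = solve-∀
        absurd : ¬ 0ℤ ≤ + N * + 2 + + N * + 2 - (+ 4 * (+ N - 1ℤ) + + 8)
        absurd h with subst (0ℤ ≤_) (eq (+ N)) h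
        ... | ()
        -- The product term accounts for the pairs with both ends in the class of `t`: they are not
        -- proper, hence not members, but count twice on the right. Its total 8 is what turns the
        -- bound `4N` into one below `4(N - 1)`.
        pointwise : ∀ u x → ⟦ member? u x ⟧ + + 2 * (T u * T x) ≤ T u + T x
        pointwise u x with member? u x | κ u ≟ κ t | κ x ≟ κ t
        ... | yes a | yes eu | yes ex = ⊥-elim (proper a (trans eu (sym ex)))
        ... | yes a | yes _  | no _   = ℤP.≤-refl
        ... | yes a | no _   | yes _  = ℤP.≤-refl
        ... | yes a | no nu  | no nx  = ⊥-elim (none (u , x , a , nu , nx))
        ... | no _  | yes _  | yes _  = ℤP.≤-refl
        ... | no _  | yes _  | no _   = +≤+ z≤n
        ... | no _  | no _   | yes _  = +≤+ z≤n
        ... | no _  | no _   | no _   = ℤP.≤-refl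
        doubled : sum₂ (λ u x → + 2 * (T u * T x)) ≡ + 8
        doubled = trans (sum₂-scale (+ 2) (λ u x → T u * T x))
                        (cong (_*_ (+ 2)) (trans (sum₂-product T T) (cong₂ _*_ (κ-fibre-size t) (κ-fibre-size t))))
        bound : count member? + + 8 ≤ + N * + 2 + + N * + 2
        bound = subst₂ _≤_
          (trans (sum₂-+ (λ u x → ⟦ member? u x ⟧) (λ u x → + 2 * (T u * T x))) (cong (_+_ (count member?)) doubled))
          (trans (sum₂-+ {N} {N} (λ u _ → T u) (λ _ x → T x))
                 (cong₂ _+_ (trans (sum₂-left {N} {N} T) (cong (_*_ (+ N)) (κ-fibre-size t)))
                            (trans (sum₂-right {N} {N} T) (cong (_*_ (+ N)) (κ-fibre-size t)))))
          (sum₂-mono pointwise)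

      outside? : ∀ p q z u → Dec (κ u ≢ p × κ u ≢ q × κ u ≢ z)
      outside? p q z u = ¬? (κ u ≟ p) ×-dec ¬? (κ u ≟ q) ×-dec ¬? (κ u ≟ z)

      -- Otherwise all members would have both ends among the six vertices of three matching edges,
      -- which leaves at most 36 pairs.
      leave-classes : ∀ p q z → ∃₂ λ s t → Joined A s t × s ≢ p × s ≢ q × s ≢ z
      leave-classes p q z
        with any? (λ u → any? λ x → member? u x ×-dec (outside? p q z u ⊎-dec outside? p q z x))
      ... | yes (u , x , a , inj₁ o) = κ u , κ x , joined a , o
      ... | yes (u , x , a , inj₂ o) = κ x , κ u , Joined-sym (joined a) , o
      ... | no none = ⊥-elim (count-small F (cartesianProduct S S) (ℕP.m≤m+n 36 3) λ {u} {x} a →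
                        ∈-cartesianProduct⁺ (inside u λ o → none (u , x , a , inj₁ o))
                                            (inside x λ o → none (u , x , a , inj₂ o)))
        where
        S = p ∷ partner p ∷ q ∷ partner q ∷ z ∷ partner z ∷ []
        inside : ∀ u → ¬ (κ u ≢ p × κ u ≢ q × κ u ≢ z) → u ∈ S
        inside u ¬o with κ u ≟ p | κ u ≟ q | κ u ≟ z
        ... | yes e | _ | _ = [ here , there ∘ here ]′ (κ-fibre e)
        ... | no _ | yes e | _ = there (there ([ here , there ∘ here ]′ (κ-fibre e)))
        ... | no _ | no _ | yes e = there (there (there (there ([ here , there ∘ here ]′ (κ-fibre e)))))
        ... | no a | no b | no c = ⊥-elim (¬o (a , b , c))

    -- Every member of `B` would have to meet both of two disjoint members of `A`, thus have one end
    -- in each of two sets of four vertices. There are only `2 * 4 * 4 = 32` such ordered pairs.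
    no-disjoint-pair : ∀ {A B} → LargeFamily B → CrossMeeting A B →
      ∀ {s t s′ t′} → Joined A s t → Joined A s′ t′ → Meet s t s′ t′
    no-disjoint-pair {A} {B} G cross {s} {t} {s′} {t′} a a′ with Meet? s t s′ t′
    ... | yes m = m
    ... | no ¬m = ⊥-elim (count-small G L (ℕP.m≤m+n 32 7) covered)
      where
      P P′ : List (Fin N)
      P  = s ∷ partner s ∷ t ∷ partner t ∷ []
      P′ = s′ ∷ partner s′ ∷ t′ ∷ partner t′ ∷ []
      L = cartesianProduct P P′ ++ cartesianProduct P′ P
      In : Fin N → Fin N → Fin N → Set
      In s t v = s ≡ κ v ⊎ t ≡ κ v
      list : ∀ {s t v} → In s t v → v ∈ (s ∷ partner s ∷ t ∷ partner t ∷ [])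
      list (inj₁ e) = [ here , there ∘ here ]′ (κ-fibre (sym e))
      list (inj₂ e) = there (there ([ here , there ∘ here ]′ (κ-fibre (sym e))))
      split : ∀ {s t v y} → Meet s t (κ v) (κ y) → In s t v ⊎ In s t y
      split (inj₁ (inj₁ e)) = inj₁ (inj₁ e)
      split (inj₁ (inj₂ e)) = inj₂ (inj₁ e)
      split (inj₂ (inj₁ e)) = inj₁ (inj₂ e)
      split (inj₂ (inj₂ e)) = inj₂ (inj₂ e)
      apart : ∀ {v} → In s t v → ¬ In s′ t′ v
      apart (inj₁ e) (inj₁ e′) = ¬m (inj₁ (inj₁ (trans e (sym e′))))
      apart (inj₁ e) (inj₂ e′) = ¬m (inj₁ (inj₂ (trans e (sym e′))))
      apart (inj₂ e) (inj₁ e′) = ¬m (inj₂ (inj₁ (trans e (sym e′))))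
      apart (inj₂ e) (inj₂ e′) = ¬m (inj₂ (inj₂ (trans e (sym e′))))
      covered : ∀ {v y} → B v y → (v , y) ∈ L
      covered b with split (cross a (joined b)) | split (cross a′ (joined b))
      ... | inj₁ i | inj₁ j = ⊥-elim (apart i j)
      ... | inj₂ i | inj₂ j = ⊥-elim (apart i j)
      ... | inj₁ i | inj₂ j = ∈-++⁺ˡ (∈-cartesianProduct⁺ (list i) (list j))
      ... | inj₂ i | inj₁ j = ∈-++⁺ʳ (cartesianProduct P P′) (∈-cartesianProduct⁺ (list j) (list i))

    -- Suppose all members meet and take pq in B. Members of A avoiding p and q, respectively,
    -- meet pq and, by no-disjoint-pair, each other: they are qz and pz. A member of B leaving
    -- the triangle pqz must contain z, so it is disjoint from pq, contradicting no-disjoint-pair for B.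
    not-cross-meeting : ∀ {A B} → LargeFamily A → LargeFamily B → ¬ CrossMeeting A B
    not-cross-meeting {A} {B} F G cross with avoid-class G (Fin.fromℕ< N≥11)
    ... | p₀ , q₀ , b , _ = contra
      where
      p = κ p₀
      q = κ q₀
      p≢q : p ≢ q
      p≢q = LargeFamily.proper G b
      rest : ∀ r₀ r → (∀ {s t} → Joined A s t → Meet (κ r₀) r s t) → ∃ λ z → Joined A r z × z ≢ κ r₀
      rest r₀ r meets with avoid-class F r₀
      ... | u , x , a , nu , nx with meets (joined a)
      ...   | inj₁ (inj₁ e) = ⊥-elim (nu (sym e))
      ...   | inj₁ (inj₂ e) = ⊥-elim (nx (sym e))
      ...   | inj₂ (inj₁ refl) = κ x , joined a , nx
      ...   | inj₂ (inj₂ refl) = κ u , Joined-sym (joined a) , nu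
      contra : ⊥
      contra with rest p₀ q (λ a → Meet-sym (cross a (joined b)))
                | rest q₀ p (λ a → swap-meet (Meet-sym (cross a (joined b))))
      ... | z , a₁ , z≢p | w , a₂ , w≢q with no-disjoint-pair G cross a₁ a₂
      ... | inj₁ (inj₁ e) = p≢q (sym e)
      ... | inj₁ (inj₂ e) = w≢q (sym e)
      ... | inj₂ (inj₁ e) = z≢p e
      ... | inj₂ (inj₂ refl) with leave-classes G p q z
      ... | t , s , b′ , t≢p , t≢q , t≢z = last (cross a₁ b′) (cross a₂ b′)
        where
        s≡z : Meet q z t s → Meet p z t s → s ≡ z
        s≡z (inj₁ (inj₁ e)) _ = ⊥-elim (t≢q (sym e))
        s≡z (inj₂ (inj₁ e)) _ = ⊥-elim (t≢z (sym e))
        s≡z (inj₂ (inj₂ e)) _ = sym e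
        s≡z (inj₁ (inj₂ e)) (inj₁ (inj₁ e′)) = ⊥-elim (t≢p (sym e′))
        s≡z (inj₁ (inj₂ e)) (inj₁ (inj₂ e′)) = ⊥-elim (p≢q (trans e′ (sym e)))
        s≡z (inj₁ (inj₂ e)) (inj₂ (inj₁ e′)) = ⊥-elim (t≢z (sym e′))
        s≡z (inj₁ (inj₂ e)) (inj₂ (inj₂ e′)) = sym e′
        last : Meet q z t s → Meet p z t s → ⊥
        last m m′ with s≡z m m′
        ... | refl with no-disjoint-pair F (λ x y → Meet-sym (cross y x)) (joined b) b′
        ... | inj₁ (inj₁ e) = t≢p (sym e)
        ... | inj₁ (inj₂ e) = z≢p (sym e)
        ... | inj₂ (inj₁ e) = t≢q (sym e)
        ... | inj₂ (inj₂ e) = joined-proper F a₁ e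

  -- Steps in the plane of gaps and their finite checks

  -- The gaps x, y between consecutive sorted colour counts become x + p, y + q, and the fields say
  -- ∣x + p∣ , ∣y + q∣ , ∣x + p + y + q∣ < x + y; written like this they are visibly monotone in x and y.
  record Improves (x y p q : ℤ) : Set where
    constructor improves
    field
      x+p<x+y      : 0ℤ < y - p
      y+q<x+y      : 0ℤ < x - q
      sum<x+y      : 0ℤ < - (p + q)
      -x-p<x+y     : 0ℤ < (x + p) + (x + y)
      -y-q<x+y     : 0ℤ < (y + q) + (x + y)
      -sum<x+y     : 0ℤ < ((x + p) + (y + q)) + (x + y)

  improves? : ∀ x y p q → Dec (Improves x y p q)
  improves? x y p q =
    map′ (λ (a , b , c , d , e , f) → improves a b c d e f) (λ (improves a b c d e f) → a , b , c , d , e , f)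
         ((0ℤ <? _) ×-dec (0ℤ <? _) ×-dec (0ℤ <? _) ×-dec (0ℤ <? _) ×-dec (0ℤ <? _) ×-dec (0ℤ <? _))

  improves-mono : ∀ {x₀ y₀ x y p q} → x₀ ≤ x → y₀ ≤ y → Improves x₀ y₀ p q → Improves x y p q
  improves-mono {p = p} {q} hx hy (improves a b c d e f) = improves
    (ℤP.<-≤-trans a (ℤP.+-monoˡ-≤ (- p) hy))
    (ℤP.<-≤-trans b (ℤP.+-monoˡ-≤ (- q) hx))
    c
    (ℤP.<-≤-trans d (ℤP.+-mono-≤ (ℤP.+-monoˡ-≤ p hx) (ℤP.+-mono-≤ hx hy)))
    (ℤP.<-≤-trans e (ℤP.+-mono-≤ (ℤP.+-monoˡ-≤ q hy) (ℤP.+-mono-≤ hx hy)))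
    (ℤP.<-≤-trans f (ℤP.+-mono-≤ (ℤP.+-mono-≤ (ℤP.+-monoˡ-≤ p hx) (ℤP.+-monoˡ-≤ q hy)) (ℤP.+-mono-≤ hx hy)))

  -- Contribution of one edge to the two gaps, by the rank of its colour in the sorted order.
  gain₁ gain₂ : Fin 3 → ℤ
  gain₁ 0F = 1ℤ
  gain₁ 1F = -1ℤ
  gain₁ 2F = 0ℤ
  gain₂ 0F = 0ℤ
  gain₂ 1F = 1ℤ
  gain₂ 2F = -1ℤ

  -- Ranks of the colours of the two new and of the two old edges of a switch.
  Quad : Set
  Quad = Fin 3 × Fin 3 × Fin 3 × Fin 3

  exchange : (Fin 3 → ℤ) → Quad → ℤ
  exchange w (a , b , c , d) = w a + w b - (w c + w d)

  step₁ step₂ : Quad → ℤ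
  step₁ = exchange gain₁
  step₂ = exchange gain₂

  -- There are only 81 quads, so statements about all possible steps can be settled by evaluation.
  every-quad? : {P : Quad → Set} → (∀ s → Dec (P s)) → Dec (∀ s → P s)
  every-quad? P? =
    map′ (λ { h (a , b , c , d) → h a b c d }) (λ h a b c d → h (a , b , c , d))
         (all? λ a → all? λ b → all? λ c → all? λ d → P? (a , b , c , d))

  -- `origin∉` keeps degenerate pairs, whose step is zero, out of every region, so that members of a
  -- region stand for genuine switches.
  record Region : Set₁ where
    field
      Holds : ℤ → ℤ → Set
      holds? : ∀ p q → Dec (Holds p q)
      origin∉ : ¬ Holds 0ℤ 0ℤ
  open Region

  -- The steps add up to a negative multiple of the gaps; the sign makes the total height
  -- nonnegative when the gaps are.
  height : (α β : ℕ) → ℤ → ℤ → ℤ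
  height α β p q = - (+ α * p + + β * q)

  origin-height : ∀ α β → height α β 0ℤ 0ℤ ≡ 0ℤ
  origin-height α β rewrite ℤP.*-zeroʳ (+ α) | ℤP.*-zeroʳ (+ β) = refl

  downhill : (α β : ℕ) → Region
  downhill α β .Holds p q = 0ℤ < height α β p q
  downhill α β .holds? p q = 0ℤ <? _
  downhill α β .origin∉ h = ℤP.<-irrefl refl (subst (0ℤ <_) (origin-height α β) h)

  _∩_ : Region → {P : ℤ → ℤ → Set} → (∀ p q → Dec (P p q)) → Region
  _∩_ R {P} P? .Holds p q = Holds R p q × P p q
  (R ∩ P?) .holds? p q = holds? R p q ×-dec P? p q
  (R ∩ P?) .origin∉ (h , _) = origin∉ R h

  -- Improves is monotone in the gaps, so a step that is stuck at (x , y) is stuck at every smaller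
  -- (x₀ , y₀), and a statement about stuck steps has to be checked for a single (x₀ , y₀) only.
  module Check (x₀ y₀ : ℤ) where

    Stuck : Quad → Set
    Stuck s = ¬ Improves x₀ y₀ (step₁ s) (step₂ s)

    stuck? : ∀ s → Dec (Stuck s)
    stuck? s = ¬? (improves? x₀ y₀ (step₁ s) (step₂ s))

    Bounded : (α β c : ℕ) → Quad → Set
    Bounded α β c s = Stuck s → 0ℤ < height α β (step₁ s) (step₂ s) → height α β (step₁ s) (step₂ s) ≤ + c

    bounded? : ∀ α β c → Dec (∀ s → Bounded α β c s)
    bounded? α β c = every-quad? λ s → stuck? s →-dec ((0ℤ <? _) →-dec (_ ≤? _))

    Compatible : Region → Region → Quad → Set
    Compatible R R′ s = Stuck s → Holds R (step₁ s) (step₂ s) → ∀ s′ →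
      Stuck s′ → Holds R′ (step₁ s′) (step₂ s′) → Improves x₀ y₀ (step₁ s + step₁ s′) (step₂ s + step₂ s′)

    compatible? : ∀ R R′ → Dec (∀ s → Compatible R R′ s)
    compatible? R R′ = every-quad? λ s → stuck? s →-dec (holds? R _ _ →-dec
      every-quad? λ s′ → stuck? s′ →-dec (holds? R′ _ _ →-dec improves? x₀ y₀ (step₁ s + step₁ s′) (step₂ s + step₂ s′)))

  -- Averaging linear forms over all switches

  module Moves {N : ℕ} (quad : Fin N → Fin N → Quad) (x y K : ℤ) (0≤K : 0ℤ ≤ K)
    (total₁ : sum₂ (λ u v → step₁ (quad u v)) ≡ - (K * x))
    (total₂ : sum₂ (λ u v → step₂ (quad u v)) ≡ - (K * y))
    (stuck : ∀ u v → ¬ Improves x y (step₁ (quad u v)) (step₂ (quad u v)))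
    where

    In : Region → Fin N → Fin N → Set
    In R u v = Holds R (step₁ (quad u v)) (step₂ (quad u v))

    in? : ∀ R u v → Dec (In R u v)
    in? R u v = holds? R (step₁ (quad u v)) (step₂ (quad u v))

    size : Region → ℤ
    size R = sum₂ λ u v → ⟦ in? R u v ⟧

    height-at : (α β : ℕ) → Fin N → Fin N → ℤ
    height-at α β u v = height α β (step₁ (quad u v)) (step₂ (quad u v))

    total-height : ∀ α β → sum₂ (height-at α β) ≡ K * (+ α * x + + β * y)
    total-height α β = begin
      sum₂ (height-at α β)
        ≡⟨ sum₂-cong (λ u v → expand (+ α) (+ β) (step₁ (quad u v)) (step₂ (quad u v))) ⟩
      sum₂ (λ u v → - (+ α) * step₁ (quad u v) + - (+ β) * step₂ (quad u v))
        ≡⟨ sum₂-+ (λ u v → - (+ α) * step₁ (quad u v)) (λ u v → - (+ β) * step₂ (quad u v)) ⟩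
      sum₂ (λ u v → - (+ α) * step₁ (quad u v)) + sum₂ (λ u v → - (+ β) * step₂ (quad u v))
        ≡⟨ cong₂ _+_ (sum₂-scale (- (+ α)) (λ u v → step₁ (quad u v))) (sum₂-scale (- (+ β)) (λ u v → step₂ (quad u v))) ⟩
      - (+ α) * sum₂ (λ u v → step₁ (quad u v)) + - (+ β) * sum₂ (λ u v → step₂ (quad u v))
        ≡⟨ cong₂ (λ s t → - (+ α) * s + - (+ β) * t) total₁ total₂ ⟩
      - (+ α) * - (K * x) + - (+ β) * - (K * y)
        ≡⟨ collect (+ α) (+ β) K x y ⟩
      K * (+ α * x + + β * y) ∎
      where
      open ≡-Reasoning
      expand : ∀ a b p q → - (a * p + b * q) ≡ - a * p + - b * q
      expand = solve-∀
      collect : ∀ a b K x y → - a * - (K * x) + - b * - (K * y) ≡ K * (a * x + b * y)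
      collect = solve-∀

    module _ {x₀ y₀ : ℤ} (x₀≤x : x₀ ≤ x) (y₀≤y : y₀ ≤ y) where
      open Check x₀ y₀

      still-stuck : ∀ u v → Stuck (quad u v)
      still-stuck u v = stuck u v ∘ improves-mono x₀≤x y₀≤y

      -- Averaging: pairs of nonpositive height cannot help to reach the total `K * (α x + β y)`,
      -- and each of the others, being stuck, contributes at most `c`.
      size-downhill : ∀ m α β c → .{{_ : ℕ.NonZero c}} → (∀ s → Bounded α β c s) →
                      + m * + c ≤ + α * x₀ + + β * y₀ → + m * K ≤ size (downhill α β)
      size-downhill m α β (suc c) bounded mc≤ = ℤP.*-cancelˡ-≤-pos (+ m * K) (size (downhill α β)) (+ suc c) (begin
        + suc c * (+ m * K)                     ≡⟨ rearrange (+ suc c) (+ m) K ⟩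
        K * (+ m * + suc c)                     ≤⟨ ℤP.*-monoˡ-≤-nonNeg K {{ℤ.nonNegative 0≤K}} (ℤP.≤-trans mc≤
                                                     (ℤP.+-mono-≤ (ℤP.*-monoˡ-≤-nonNeg (+ α) x₀≤x) (ℤP.*-monoˡ-≤-nonNeg (+ β) y₀≤y))) ⟩
        K * (+ α * x + + β * y)                 ≡⟨ total-height α β ⟨
        sum₂ (height-at α β)                    ≤⟨ sum₂-mono pointwise ⟩
        sum₂ (λ u v → + suc c * ⟦ in? (downhill α β) u v ⟧) ≡⟨ sum₂-scale (+ suc c) (λ u v → ⟦ in? (downhill α β) u v ⟧) ⟩
        + suc c * size (downhill α β)           ∎)
        where
        open ℤP.≤-Reasoning
        rearrange : ∀ c m K → c * (m * K) ≡ K * (m * c)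
        rearrange = solve-∀
        pointwise : ∀ u v → height-at α β u v ≤ + suc c * ⟦ in? (downhill α β) u v ⟧
        pointwise u v with in? (downhill α β) u v
        ... | yes h = subst (height-at α β u v ≤_) (sym (ℤP.*-identityʳ (+ suc c))) (bounded (quad u v) (still-stuck u v) h)
        ... | no ¬h = subst (height-at α β u v ≤_) (sym (ℤP.*-zeroʳ (+ suc c))) (ℤP.≮⇒≥ ¬h)

    size-split : ∀ R {P : ℤ → ℤ → Set} (P? : ∀ p q → Dec (P p q)) →
                 + 2 * K ≤ size R → K ≤ size (R ∩ P?) ⊎ K ≤ size (R ∩ λ p q → ¬? (P? p q))
    size-split R P? 2K≤ with K ≤? size (R ∩ P?)
    ... | yes K≤ = inj₁ K≤
    ... | no K≰ = inj₂ (ℤP.≮⇒≥ λ <K → ℤP.<⇒≱ (ℤP.+-mono-< (ℤP.≰⇒> K≰) <K)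
                    (subst₂ _≤_ (double K) split 2K≤))
      where
      double : ∀ k → + 2 * k ≡ k + k
      double = solve-∀
      split : size R ≡ size (R ∩ P?) + size (R ∩ λ p q → ¬? (P? p q))
      split = trans (sum₂-cong pointwise) (sum₂-+ (λ u v → ⟦ in? (R ∩ P?) u v ⟧) _)
        where
        pointwise : ∀ u v → ⟦ in? R u v ⟧ ≡ ⟦ in? (R ∩ P?) u v ⟧ + ⟦ in? (R ∩ λ p q → ¬? (P? p q)) u v ⟧
        pointwise u v with holds? R (step₁ (quad u v)) (step₂ (quad u v)) | P? (step₁ (quad u v)) (step₂ (quad u v))
        ... | yes _ | yes _ = refl
        ... | yes _ | no _  = refl
        ... | no _  | yes _ = refl
        ... | no _  | no _  = refl

  -- Wide gaps are incompatible with being stuck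

  module Deadlock {N : ℕ} (partner κ : Fin N → Fin N)
    (κ-fibre : ∀ {u s} → κ u ≡ s → u ≡ s ⊎ u ≡ partner s)
    (κ-fibre-size : ∀ t → sum (λ u → ⟦ κ u ≟ κ t ⟧) ≡ + 2)
    (N≥11 : 11 ℕ.≤ N)
    (quad : Fin N → Fin N → Quad)
    (degenerate : ∀ u v → κ u ≡ κ v → step₁ (quad u v) ≡ 0ℤ × step₂ (quad u v) ≡ 0ℤ)
    (x y : ℤ)
    (total₁ : sum₂ (λ u v → step₁ (quad u v)) ≡ - (+ 4 * (+ N - 1ℤ) * x))
    (total₂ : sum₂ (λ u v → step₂ (quad u v)) ≡ - (+ 4 * (+ N - 1ℤ) * y))
    (stuck : ∀ u v → ¬ Improves x y (step₁ (quad u v)) (step₂ (quad u v)))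
    (stuck₂ : ∀ u v u′ v′ → ¬ Disjoint.Meet partner κ κ-fibre κ-fibre-size N≥11 (κ u) (κ v) (κ u′) (κ v′) →
              ¬ Improves x y (step₁ (quad u v) + step₁ (quad u′ v′)) (step₂ (quad u v) + step₂ (quad u′ v′)))
    where

    open Disjoint partner κ κ-fibre κ-fibre-size N≥11

    K : ℤ
    K = + 4 * (+ N - 1ℤ)

    0≤K : 0ℤ ≤ K
    0≤K = ℤP.*-monoˡ-≤-nonNeg (+ 4) (ℤP.i≤j⇒0≤j-i (+≤+ (ℕP.≤-trans (s≤s z≤n) N≥11)))

    open Moves quad x y K 0≤K total₁ total₂ stuck

    family : ∀ R → K ≤ size R → LargeFamily (In R)
    family R K≤ = record
      { member? = in? R
      ; proper  = λ {u} {v} h e → let z₁ , z₂ = degenerate u v e in origin∉ R (subst₂ (Holds R) z₁ z₂ h)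
      ; large   = K≤
      }

    clash : ∀ {x₀ y₀} → x₀ ≤ x → y₀ ≤ y → ∀ R R′ → (∀ s → Check.Compatible x₀ y₀ R R′ s) →
            K ≤ size R → ¬ K ≤ size R′
    clash x₀≤x y₀≤y R R′ compatible K≤R K≤R′ =
      not-cross-meeting (family R K≤R) (family R′ K≤R′) (cross-meeting λ {u} {v} {u′} {v′} h h′ → meet u v u′ v′ h h′)
      where
      meet : ∀ u v u′ v′ → In R u v → In R′ u′ v′ → Meet (κ u) (κ v) (κ u′) (κ v′)
      meet u v u′ v′ h h′ with Meet? (κ u) (κ v) (κ u′) (κ v′)
      ... | yes m = m
      ... | no ¬m = ⊥-elim (stuck₂ u v u′ v′ ¬m (improves-mono x₀≤x y₀≤y
                      (compatible (quad u v) (still-stuck x₀≤x y₀≤y u v) h (quad u′ v′) (still-stuck x₀≤x y₀≤y u′ v′) h′)))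

    1K : ∀ {i} → + 1 * K ≤ i → K ≤ i
    1K = subst (_≤ _) (ℤP.*-identityˡ K)

    -- The stuck steps of positive height lie in two regions, one of which holds at least K of them;
    -- a second linear form then provides K steps that are compatible with these.
    no-wide-gap₁ : + 3 ≤ x → ¬ 0ℤ ≤ y
    no-wide-gap₁ hx hy
      -- At `(3 , 0)` only the stuck steps `(0 , -3)` and `(-3 , 3)` have positive height for this
      -- form, both of height 3 against a total of at least `6K`; hence `2K` pairs. The sign of `q`
      -- separates the two. The second form is chosen so that every stuck step of positive height
      -- compensates the given one.
      with size-split (downhill 2 1) (λ p q → q <? 0ℤ)
             (size-downhill hx hy 2 2 1 3 (from-yes (Check.bounded? (+ 3) 0ℤ 2 1 3)) (from-yes (+ 6 ≤? + 6)))
    ... | inj₁ K≤ = clash hx hy (downhill 2 1 ∩ λ p q → q <? 0ℤ) (downhill 1 0)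
      (from-yes (Check.compatible? (+ 3) 0ℤ (downhill 2 1 ∩ λ p q → q <? 0ℤ) (downhill 1 0))) K≤
      (1K (size-downhill hx hy 1 1 0 3 (from-yes (Check.bounded? (+ 3) 0ℤ 1 0 3)) (from-yes (+ 3 ≤? + 3))))
    ... | inj₂ K≤ = clash hx hy (downhill 2 1 ∩ λ p q → ¬? (q <? 0ℤ)) (downhill 1 1)
      (from-yes (Check.compatible? (+ 3) 0ℤ (downhill 2 1 ∩ λ p q → ¬? (q <? 0ℤ)) (downhill 1 1))) K≤
      (1K (size-downhill hx hy 1 1 1 3 (from-yes (Check.bounded? (+ 3) 0ℤ 1 1 3)) (from-yes (+ 3 ≤? + 3))))

    -- Mirror image of `no-wide-gap₁`: both the set of possible steps and `Improves` are symmetric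
    -- under exchanging the two gaps.
    no-wide-gap₂ : 0ℤ ≤ x → ¬ + 3 ≤ y
    no-wide-gap₂ hx hy
      with size-split (downhill 1 2) (λ p q → p <? 0ℤ)
             (size-downhill hx hy 2 1 2 3 (from-yes (Check.bounded? 0ℤ (+ 3) 1 2 3)) (from-yes (+ 6 ≤? + 6)))
    ... | inj₁ K≤ = clash hx hy (downhill 1 2 ∩ λ p q → p <? 0ℤ) (downhill 0 1)
      (from-yes (Check.compatible? 0ℤ (+ 3) (downhill 1 2 ∩ λ p q → p <? 0ℤ) (downhill 0 1))) K≤
      (1K (size-downhill hx hy 1 0 1 3 (from-yes (Check.bounded? 0ℤ (+ 3) 0 1 3)) (from-yes (+ 3 ≤? + 3))))
    ... | inj₂ K≤ = clash hx hy (downhill 1 2 ∩ λ p q → ¬? (p <? 0ℤ)) (downhill 1 1)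
      (from-yes (Check.compatible? 0ℤ (+ 3) (downhill 1 2 ∩ λ p q → ¬? (p <? 0ℤ)) (downhill 1 1))) K≤
      (1K (size-downhill hx hy 1 1 1 3 (from-yes (Check.bounded? 0ℤ (+ 3) 1 1 3)) (from-yes (+ 3 ≤? + 3))))

    -- At `(2 , 2)` the stuck steps of positive height for the form `p + q` are `(-4 , 2)` and
    -- `(2 , -4)`, both of height 2. The partners of `(2 , -4)` found by the second form are
    -- `(-4 , 2)` and `(-3 , 3)`, with sums `(-2 , -2)` and `(-1 , -1)`; the other case is
    -- symmetric.
    no-wide-gaps : + 2 ≤ x → ¬ + 2 ≤ y
    no-wide-gaps hx hy
      with size-split (downhill 1 1) (λ p q → q <? p)
             (size-downhill hx hy 2 1 1 2 (from-yes (Check.bounded? (+ 2) (+ 2) 1 1 2)) (from-yes (+ 4 ≤? + 4)))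
    ... | inj₁ K≤ = clash hx hy (downhill 1 1 ∩ λ p q → q <? p) (downhill 2 1)
      (from-yes (Check.compatible? (+ 2) (+ 2) (downhill 1 1 ∩ λ p q → q <? p) (downhill 2 1))) K≤
      (1K (size-downhill hx hy 1 2 1 6 (from-yes (Check.bounded? (+ 2) (+ 2) 2 1 6)) (from-yes (+ 6 ≤? + 6))))
    ... | inj₂ K≤ = clash hx hy (downhill 1 1 ∩ λ p q → ¬? (q <? p)) (downhill 1 2)
      (from-yes (Check.compatible? (+ 2) (+ 2) (downhill 1 1 ∩ λ p q → ¬? (q <? p)) (downhill 1 2))) K≤
      (1K (size-downhill hx hy 1 1 2 6 (from-yes (Check.bounded? (+ 2) (+ 2) 1 2 6)) (from-yes (+ 6 ≤? + 6))))

  -- Double counting of coloured edges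

  length-filter-tabulate : ∀ {A : Set} {P : A → Set} (P? : ∀ a → Dec (P a)) {n} (g : Fin n → A) →
                           + length (filter P? (tabulate g)) ≡ sum (λ i → ⟦ P? (g i) ⟧)
  length-filter-tabulate P? {zero}  g = refl
  length-filter-tabulate P? {suc n} g with P? (g Fin.zero)
  ... | yes _ = cong (_+_ 1ℤ) (length-filter-tabulate P? (g ∘ Fin.suc))
  ... | no _  = trans (length-filter-tabulate P? (g ∘ Fin.suc)) (sym (ℤP.+-identityˡ _))

  length-filter-cartesianProduct :
    ∀ {A B : Set} {P : A × B → Set} (P? : ∀ p → Dec (P p)) {m n} (g : Fin m → A) (h : Fin n → B) →
    + length (filter P? (cartesianProduct (tabulate g) (tabulate h))) ≡ sum₂ (λ i j → ⟦ P? (g i , h j) ⟧)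
  length-filter-cartesianProduct P? {zero}  g h = refl
  length-filter-cartesianProduct P? {suc m} g h = begin
    + length (filter P? (row ++ rest))
      ≡⟨ cong (λ l → + length l) (ListP.filter-++ P? row rest) ⟩
    + length (filter P? row ++ filter P? rest)
      ≡⟨ cong +_ (ListP.length-++ (filter P? row)) ⟩
    + length (filter P? row) + + length (filter P? rest)
      ≡⟨ cong₂ _+_ (trans (cong (λ l → + length (filter P? l)) (ListP.map-tabulate h (g Fin.zero ,_)))
                          (length-filter-tabulate P? (λ j → g Fin.zero , h j)))
                   (length-filter-cartesianProduct P? (g ∘ Fin.suc) h) ⟩
    sum₂ (λ i j → ⟦ P? (g i , h j) ⟧) ∎
    where
    open ≡-Reasoning
    row  = map (g Fin.zero ,_) (tabulate h)
    rest = cartesianProduct (tabulate (g ∘ Fin.suc)) (tabulate h)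

  involution : ∀ {n} (p : Fin n → Fin n) → (∀ i → p (p i) ≡ i) → Permutation n n
  involution p inv = Perm.permutation p p inv inv

  distinct : ∀ {n} → Fin n → Fin n → ℤ
  distinct u x = 1ℤ - ⟦ u ≟ x ⟧

  trichotomous : ∀ {L G E P : Set} (L? : Dec L) (G? : Dec G) (E? : Dec E) (P? : Dec P) →
                 (L → ¬ E) → (G → ¬ E) → (L → ¬ G) → (¬ L → ¬ G → E) →
                 ⟦ L? ×-dec P? ⟧ + ⟦ G? ×-dec P? ⟧ ≡ (1ℤ - ⟦ E? ⟧) * ⟦ P? ⟧
  trichotomous (yes l) _ (yes e) _ l≠e _ _ _ = ⊥-elim (l≠e l e)
  trichotomous (no _) (yes g) (yes e) _ _ g≠e _ _ = ⊥-elim (g≠e g e)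
  trichotomous (no _) (no _) (yes _) (yes _) _ _ _ _ = refl
  trichotomous (no _) (no _) (yes _) (no _) _ _ _ _ = refl
  trichotomous (yes l) (yes g) (no _) _ _ _ l≠g _ = ⊥-elim (l≠g l g)
  trichotomous (yes _) (no _) (no _) (yes _) _ _ _ _ = refl
  trichotomous (yes _) (no _) (no _) (no _) _ _ _ _ = refl
  trichotomous (no _) (yes _) (no _) (yes _) _ _ _ _ = refl
  trichotomous (no _) (yes _) (no _) (no _) _ _ _ _ = refl
  trichotomous (no ¬l) (no ¬g) (no ¬e) _ _ _ _ total = ⊥-elim (¬e (total ¬l ¬g))

  -- Colour classes and matchings count an edge at its smaller endpoint only. Adding both
  -- orientations removes the order and leaves a symmetric sum.
  orient : ∀ {n} {P : Set} (a b : Fin n) (P? : Dec P) →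
           ⟦ (toℕ a ℕP.<? toℕ b) ×-dec P? ⟧ + ⟦ (toℕ b ℕP.<? toℕ a) ×-dec P? ⟧ ≡ distinct a b * ⟦ P? ⟧
  orient a b P? = trichotomous (toℕ a ℕP.<? toℕ b) (toℕ b ℕP.<? toℕ a) (a ≟ b) P?
    (λ a<b e → ℕP.<-irrefl (cong toℕ e) a<b) (λ b<a e → ℕP.<-irrefl (cong toℕ (sym e)) b<a) ℕP.<-asym
    (λ a≮b b≮a → toℕ-injective (ℕP.≤-antisym (ℕP.≮⇒≥ b≮a) (ℕP.≮⇒≥ a≮b)))

  module Colouring {N : ℕ} (c : EdgeColouring N) where

    sum-distinct-colour : ∀ k → sum₂ (λ u x → distinct u x * ⟦ col c u x ≟ k ⟧) ≡ + 2 * + colourClassSize c k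
    sum-distinct-colour k = begin
      sum₂ (λ u x → distinct u x * ⟦ col c u x ≟ k ⟧)
        ≡⟨ sum₂-cong (λ u x → sym (orient u x (col c u x ≟ k))) ⟩
      sum₂ (λ u x → below u x + ⟦ (toℕ x ℕP.<? toℕ u) ×-dec (col c u x ≟ k) ⟧)
        ≡⟨ sum₂-+ below _ ⟩
      sum₂ below + sum₂ (λ u x → ⟦ (toℕ x ℕP.<? toℕ u) ×-dec (col c u x ≟ k) ⟧)
        ≡⟨ cong (_+_ (sum₂ below)) (trans
             (sum₂-cong λ u x → cong (λ d → ⟦ (toℕ x ℕP.<? toℕ u) ×-dec (d ≟ k) ⟧) (col-sym c u x))
             (∑-comm (λ u x → below x u))) ⟩
      sum₂ below + sum₂ below
        ≡⟨ cong (λ s → s + s) (sym (length-filter-cartesianProduct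
             (λ p → (toℕ (proj₁ p) ℕP.<? toℕ (proj₂ p)) ×-dec (col c (proj₁ p) (proj₂ p) ≟ k)) id id)) ⟩
      + colourClassSize c k + + colourClassSize c k
        ≡⟨ double (+ colourClassSize c k) ⟩
      + 2 * + colourClassSize c k ∎
      where
      open ≡-Reasoning
      below : Fin N → Fin N → ℤ
      below u x = ⟦ (toℕ u ℕP.<? toℕ x) ×-dec (col c u x ≟ k) ⟧
      double : ∀ s → s + s ≡ + 2 * s
      double = solve-∀

    module _ (M : PerfectMatching N) where

      private p = partner M

      reindex : ∀ (f : Fin N → ℤ) → sum (f ∘ p) ≡ sum f
      reindex f = sym (sum-permute f (involution p (involutive M)))

      sum-matched-colour : ∀ k → sum (λ t → ⟦ col c t (p t) ≟ k ⟧) ≡ + 2 * + matchedOfColour c M k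
      sum-matched-colour k = begin
        sum (λ t → ⟦ col c t (p t) ≟ k ⟧)
          ≡⟨ sum-cong-≗ (λ t → trans (sym (ℤP.*-identityˡ _)) (trans
               (cong (λ d → (1ℤ - d) * ⟦ col c t (p t) ≟ k ⟧) (sym (⟦⟧-no (t ≟ p t) (noFixed M t ∘ sym))))
               (sym (orient t (p t) (col c t (p t) ≟ k))))) ⟩
        sum (λ t → below t + ⟦ (toℕ (p t) ℕP.<? toℕ t) ×-dec (col c t (p t) ≟ k) ⟧)
          ≡⟨ ∑-distrib-+ below _ ⟩
        sum below + sum (λ t → ⟦ (toℕ (p t) ℕP.<? toℕ t) ×-dec (col c t (p t) ≟ k) ⟧)
          ≡⟨ cong (_+_ (sum below)) (trans (sum-cong-≗ flipped) (reindex below)) ⟩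
        sum below + sum below
          ≡⟨ cong (λ s → s + s) (sym (length-filter-tabulate
               (λ i → (toℕ i ℕP.<? toℕ (p i)) ×-dec (col c i (p i) ≟ k)) id)) ⟩
        + matchedOfColour c M k + + matchedOfColour c M k
          ≡⟨ double (+ matchedOfColour c M k) ⟩
        + 2 * + matchedOfColour c M k ∎
        where
        open ≡-Reasoning
        below : Fin N → ℤ
        below t = ⟦ (toℕ t ℕP.<? toℕ (p t)) ×-dec (col c t (p t) ≟ k) ⟧
        flipped : ∀ t → ⟦ (toℕ (p t) ℕP.<? toℕ t) ×-dec (col c t (p t) ≟ k) ⟧ ≡ below (p t)
        flipped t = trans
          (cong (λ d → ⟦ (toℕ (p t) ℕP.<? toℕ t) ×-dec (d ≟ k) ⟧) (col-sym c t (p t)))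
          (cong (λ s → ⟦ (toℕ (p t) ℕP.<? toℕ s) ×-dec (col c (p t) s ≟ k) ⟧) (sym (involutive M t)))
        double : ∀ s → s + s ≡ + 2 * s
        double = solve-∀

      matched-weight : (w : Fin 3 → ℤ) → sum (λ t → w (col c t (p t))) ≡ + 2 * sum (λ k → w k * + matchedOfColour c M k)
      matched-weight w = begin
        sum (λ t → w (col c t (p t)))
          ≡⟨ sum-cong-≗ (λ t → expand-at w (col c t (p t))) ⟩
        sum (λ t → sum (λ k → w k * ⟦ col c t (p t) ≟ k ⟧))
          ≡⟨ ∑-comm (λ t k → w k * ⟦ col c t (p t) ≟ k ⟧) ⟩
        sum (λ k → sum (λ t → w k * ⟦ col c t (p t) ≟ k ⟧))
          ≡⟨ sum-cong-≗ (λ k → trans (sum-scale (w k) (λ t → ⟦ col c t (p t) ≟ k ⟧))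
               (trans (cong (_*_ (w k)) (sum-matched-colour k)) (shuffle (w k) (+ matchedOfColour c M k)))) ⟩
        sum (λ k → + 2 * (w k * + matchedOfColour c M k))
          ≡⟨ sum-scale (+ 2) (λ k → w k * + matchedOfColour c M k) ⟩
        + 2 * sum (λ k → w k * + matchedOfColour c M k) ∎
        where
        open ≡-Reasoning
        shuffle : ∀ a b → a * (+ 2 * b) ≡ + 2 * (a * b)
        shuffle = solve-∀

    -- This is where equal class sizes enter: grouped by colour, the sum is a common factor times
    -- `sum w`.
    edge-weight : (∀ k l → colourClassSize c k ≡ colourClassSize c l) →
                  (w : Fin 3 → ℤ) → sum w ≡ 0ℤ → sum₂ (λ u x → distinct u x * w (col c u x)) ≡ 0ℤ
    edge-weight balanced w w-sum = begin
      sum₂ (λ u x → distinct u x * w (col c u x))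
        ≡⟨ sum₂-cong (λ u x → trans (cong (_*_ (distinct u x)) (expand-at w (col c u x)))
             (trans (sym (sum-scale (distinct u x) (λ k → w k * at k u x)))
                    (sum-cong-≗ λ k → shuffle (distinct u x) (w k) (at k u x)))) ⟩
      sum (λ u → sum (λ x → sum (λ k → w k * (distinct u x * at k u x))))
        ≡⟨ sum-cong-≗ (λ u → ∑-comm (λ x k → w k * (distinct u x * at k u x))) ⟩
      sum (λ u → sum (λ k → sum (λ x → w k * (distinct u x * at k u x))))
        ≡⟨ ∑-comm (λ u k → sum (λ x → w k * (distinct u x * at k u x))) ⟩
      sum (λ k → sum₂ (λ u x → w k * (distinct u x * at k u x)))
        ≡⟨ sum-cong-≗ (λ k → trans (sum₂-scale (w k) (λ u x → distinct u x * at k u x))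
             (trans (cong (_*_ (w k)) (trans (sum-distinct-colour k) (cong (λ e → + 2 * + e) (balanced k 0F))))
                    (ℤP.*-comm (w k) E₀))) ⟩
      sum (λ k → E₀ * w k)
        ≡⟨ sum-scale E₀ w ⟩
      E₀ * sum w
        ≡⟨ trans (cong (_*_ E₀) w-sum) (ℤP.*-zeroʳ E₀) ⟩
      0ℤ ∎
      where
      open ≡-Reasoning
      E₀ = + 2 * + colourClassSize c 0F
      at : Fin 3 → Fin N → Fin N → ℤ
      at k u x = ⟦ col c u x ≟ k ⟧
      shuffle : ∀ a b d → a * (b * d) ≡ b * (a * d)
      shuffle = solve-∀

  -- Switching two matching edges

  relabel : ∀ {N} → Permutation N N → PerfectMatching N → PerfectMatching N
  relabel π M .partner t = π ⟨$⟩ʳ partner M (π ⟨$⟩ˡ t)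
  relabel π M .involutive t =
    trans (cong (λ s → π ⟨$⟩ʳ partner M s) (inverseˡ π))
          (trans (cong (π ⟨$⟩ʳ_) (involutive M (π ⟨$⟩ˡ t))) (inverseʳ π))
  relabel π M .noFixed t e =
    noFixed M (π ⟨$⟩ˡ t) (trans (sym (inverseˡ π)) (cong (π ⟨$⟩ˡ_) e))

  transpose-left : ∀ {n} (a b : Fin n) → PC.transpose a b a ≡ b
  transpose-left a b with a ≟ a
  ... | yes _ = refl
  ... | no a≢a = ⊥-elim (a≢a refl)

  transpose-right : ∀ {n} (a b : Fin n) → PC.transpose a b b ≡ a
  transpose-right a b with b ≟ a
  ... | yes b≡a = b≡a
  ... | no _ with b ≟ b
  ...   | yes _ = refl
  ...   | no b≢b = ⊥-elim (b≢b refl)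

  transpose-other : ∀ {n} {a b t : Fin n} → t ≢ a → t ≢ b → PC.transpose a b t ≡ t
  transpose-other {a = a} {b} {t} t≢a t≢b with t ≟ a
  ... | yes t≡a = ⊥-elim (t≢a t≡a)
  ... | no _ with t ≟ b
  ...   | yes t≡b = ⊥-elim (t≢b t≡b)
  ...   | no _ = refl

  module Switch {N : ℕ} (M : PerfectMatching N) {u x : Fin N} (u≢x : u ≢ x) (x≢pu : x ≢ partner M u) where

    private
      p = partner M
      -- Exchanging the labels `p u` and `x` carries the edges `u (p u)` and `x (p x)` to `u x` and
      -- `(p u) (p x)`. As a conjugate of `p`, the new partner map is automatically a
      -- fixed-point-free involution.
      π = Perm.transpose (p u) x

      partner-injective : ∀ {s t} → p s ≡ p t → s ≡ t
      partner-injective {s} {t} e = trans (sym (involutive M s)) (trans (cong p e) (involutive M t))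

      u≢px : u ≢ p x
      u≢px e = x≢pu (trans (sym (involutive M x)) (cong p (sym e)))

    switch : PerfectMatching N
    switch = relabel π M

    switch-other : ∀ {t} → t ≢ u → t ≢ p u → t ≢ x → t ≢ p x → partner switch t ≡ p t
    switch-other {t} t≢u t≢pu t≢x t≢px =
      trans (cong (λ s → π ⟨$⟩ʳ p s) (transpose-other t≢x t≢pu))
            (transpose-other (t≢u ∘ partner-injective) λ e → t≢px (trans (sym (involutive M t)) (cong p e)))

    module _ (c : EdgeColouring N) (w : Fin 3 → ℤ) where

      edge : Fin N → Fin N → ℤ
      edge s t = w (col c s t)

      change : ℤ
      change = edge u x + edge (p u) (p x) - (edge u (p u) + edge x (p x))

      -- The factor 2 arises because the sums run over vertices and meet each matching edge at both
      -- ends. Reindexing by `π` leaves only the four endpoints to compare.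
      switch-weight : sum (λ t → edge t (partner switch t)) ≡ sum (λ t → edge t (p t)) + + 2 * change
      switch-weight = begin
        sum (λ t → edge t (partner switch t))
          ≡⟨ sum-permute (λ t → edge t (partner switch t)) π ⟩
        sum (λ t → edge (π ⟨$⟩ʳ t) (partner switch (π ⟨$⟩ʳ t)))
          ≡⟨ sum-cong-≗ (λ t → cong (λ s → edge (π ⟨$⟩ʳ t) (π ⟨$⟩ʳ p s)) (inverseˡ π)) ⟩
        sum (λ t → edge (π ⟨$⟩ʳ t) (π ⟨$⟩ʳ p t))
          ≡⟨ sum-change₄ moved (λ t → edge t (p t)) u (p u) x (p x)
               (noFixed M u ∘ sym) u≢x u≢px (x≢pu ∘ sym) (u≢x ∘ partner-injective) (noFixed M x ∘ sym)
               moved-other ⟩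
        sum (λ t → edge t (p t)) + ((moved u - edge u (p u)) + ((moved (p u) - edge (p u) (p (p u))) +
          ((moved x - edge x (p x)) + (moved (p x) - edge (p x) (p (p x))))))
          ≡⟨ cong (_+_ (sum λ t → edge t (p t))) (cong₂ _+_ (cong (_- edge u (p u)) moved-u)
               (cong₂ _+_ (cong₂ _-_ moved-pu (back u))
               (cong₂ _+_ (cong (_- edge x (p x)) moved-x) (cong₂ _-_ moved-px (back x))))) ⟩
        sum (λ t → edge t (p t)) + (A + (A + (B + B)))
          ≡⟨ cong (_+_ (sum λ t → edge t (p t))) (regroup (edge u x) (edge (p u) (p x)) (edge u (p u)) (edge x (p x))) ⟩
        sum (λ t → edge t (p t)) + + 2 * change ∎
        where
        open ≡-Reasoning
        A = edge u x - edge u (p u)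
        B = edge (p u) (p x) - edge x (p x)
        regroup : ∀ a b e f → (a - e) + ((a - e) + ((b - f) + (b - f))) ≡ + 2 * (a + b - (e + f))
        regroup = solve-∀
        edge-sym : ∀ s t → edge s t ≡ edge t s
        edge-sym s t = cong w (col-sym c s t)
        moved : Fin N → ℤ
        moved t = edge (π ⟨$⟩ʳ t) (π ⟨$⟩ʳ p t)
        back : ∀ t → edge (p t) (p (p t)) ≡ edge t (p t)
        back t = trans (cong (edge (p t)) (involutive M t)) (edge-sym (p t) t)
        moved-u : moved u ≡ edge u x
        moved-u = cong₂ edge (transpose-other (noFixed M u ∘ sym) u≢x) (transpose-left (p u) x)
        moved-pu : moved (p u) ≡ edge u x
        moved-pu = trans (cong₂ edge (transpose-left (p u) x)
          (trans (cong (π ⟨$⟩ʳ_) (involutive M u)) (transpose-other (noFixed M u ∘ sym) u≢x))) (edge-sym x u)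
        moved-x : moved x ≡ edge (p u) (p x)
        moved-x = cong₂ edge (transpose-right (p u) x) (transpose-other (u≢x ∘ sym ∘ partner-injective) (noFixed M x))
        moved-px : moved (p x) ≡ edge (p u) (p x)
        moved-px = trans (cong₂ edge (transpose-other (u≢x ∘ sym ∘ partner-injective) (noFixed M x))
          (trans (cong (π ⟨$⟩ʳ_) (involutive M x)) (transpose-right (p u) x))) (edge-sym (p x) (p u))
        moved-other : ∀ t → t ≢ u → t ≢ p u → t ≢ x → t ≢ p x → moved t ≡ edge t (p t)
        moved-other t t≢u t≢pu t≢x t≢px = cong₂ edge (transpose-other t≢pu t≢x)
          (transpose-other (t≢u ∘ partner-injective) λ e → t≢px (trans (sym (involutive M t)) (cong p e)))

  -- Matching edges as two-element classes of vertices

  module EdgeClasses {N : ℕ} (M : PerfectMatching N) where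

    private p = partner M

    κ : Fin N → Fin N
    κ t = if does (toℕ t ℕP.<? toℕ (p t)) then t else p t

    κ-choice : ∀ t → κ t ≡ t ⊎ κ t ≡ p t
    κ-choice t with does (toℕ t ℕP.<? toℕ (p t))
    ... | true  = inj₁ refl
    ... | false = inj₂ refl

    κ-fibre : ∀ {u s} → κ u ≡ s → u ≡ s ⊎ u ≡ p s
    κ-fibre {u} refl with κ-choice u
    ... | inj₁ e = inj₁ (sym e)
    ... | inj₂ e = inj₂ (sym (trans (cong p e) (involutive M u)))

    κ-partner : ∀ t → κ (p t) ≡ κ t
    κ-partner t = lemma (toℕ t ℕP.<? toℕ (p t)) (toℕ (p t) ℕP.<? toℕ (p (p t)))
      where
      lemma : (A? : Dec (toℕ t ℕ.< toℕ (p t))) (B? : Dec (toℕ (p t) ℕ.< toℕ (p (p t)))) →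
              (if does B? then p t else p (p t)) ≡ (if does A? then t else p t)
      lemma (yes t<pt) (yes pt<t) = ⊥-elim (ℕP.<-asym t<pt (subst (λ s → toℕ (p t) ℕ.< toℕ s) (involutive M t) pt<t))
      lemma (yes _) (no _) = involutive M t
      lemma (no _) (yes _) = refl
      lemma (no t≮pt) (no pt≮t) = ⊥-elim (noFixed M t (toℕ-injective (ℕP.≤-antisym (ℕP.≮⇒≥ t≮pt)
        (ℕP.≮⇒≥ (pt≮t ∘ subst (λ s → toℕ (p t) ℕ.< toℕ s) (sym (involutive M t)))))))

    κ-same : ∀ {u t} → κ u ≡ κ t → u ≡ t ⊎ u ≡ p t
    κ-same {u} {t} e with κ-fibre e | κ-choice t
    ... | inj₁ u≡ | inj₁ k = inj₁ (trans u≡ k)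
    ... | inj₁ u≡ | inj₂ k = inj₂ (trans u≡ k)
    ... | inj₂ u≡ | inj₁ k = inj₂ (trans u≡ (cong p k))
    ... | inj₂ u≡ | inj₂ k = inj₁ (trans u≡ (trans (cong p k) (involutive M t)))

    κ-fibre-size : ∀ t → sum (λ u → ⟦ κ u ≟ κ t ⟧) ≡ + 2
    κ-fibre-size t = begin
      sum (λ u → ⟦ κ u ≟ κ t ⟧)                    ≡⟨ sum-cong-≗ pointwise ⟩
      sum (λ u → ⟦ u ≟ t ⟧ + ⟦ u ≟ p t ⟧)          ≡⟨ ∑-distrib-+ (λ u → ⟦ u ≟ t ⟧) _ ⟩
      sum (λ u → ⟦ u ≟ t ⟧) + sum (λ u → ⟦ u ≟ p t ⟧) ≡⟨ cong₂ _+_ (sum-at t) (sum-at (p t)) ⟩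
      + 2 ∎
      where
      open ≡-Reasoning
      pointwise : ∀ u → ⟦ κ u ≟ κ t ⟧ ≡ ⟦ u ≟ t ⟧ + ⟦ u ≟ p t ⟧
      pointwise u with u ≟ t | u ≟ p t
      ... | yes refl | yes e    = ⊥-elim (noFixed M u (sym e))
      ... | yes refl | no _     = ⟦⟧-yes (κ u ≟ κ u) refl
      ... | no _     | yes refl = ⟦⟧-yes (κ (p t) ≟ κ t) (κ-partner t)
      ... | no u≢t   | no u≢pt  = ⟦⟧-no (κ u ≟ κ t) (λ e → [ u≢t , u≢pt ]′ (κ-same e))

  -- Effect of a switch on the gaps, and the total over all switches

  module Exchange {N : ℕ} (c : EdgeColouring N) (balanced : ∀ k l → colourClassSize c k ≡ colourClassSize c l)
                  (σ : Permutation 3 3) where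

    open Colouring c

    -- `σ` takes a rank to the colour holding it, so its inverse gives the rank of a colour.
    ρ : Fin 3 → Fin 3
    ρ a = σ ⟨$⟩ˡ a

    -- The values of col on the diagonal are arbitrary; the colours chosen there give the zero step.
    quad : PerfectMatching N → Fin N → Fin N → Quad
    quad M u x with u ≟ x
    ... | yes _ = 0F , 0F , 0F , 0F
    ... | no _  = ρ (col c u x) , ρ (col c (partner M u) (partner M x)) ,
                  ρ (col c u (partner M u)) , ρ (col c x (partner M x))

    quad-cong : ∀ {M M′ u x} → partner M u ≡ partner M′ u → partner M x ≡ partner M′ x → quad M u x ≡ quad M′ u x
    quad-cong {u = u} {x} eu ex with u ≟ x
    ... | yes _ = refl
    ... | no _  = cong₂ (λ s t → ρ (col c u x) , ρ (col c s t) , ρ (col c u s) , ρ (col c x t)) eu ex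

    matched : PerfectMatching N → Fin 3 → ℤ
    matched M j = + matchedOfColour c M (σ ⟨$⟩ʳ j)

    matched-weight-σ : ∀ M w → sum (λ t → w (ρ (col c t (partner M t)))) ≡ + 2 * sum (λ j → w j * matched M j)
    matched-weight-σ M w = trans (matched-weight M (w ∘ ρ)) (cong (_*_ (+ 2)) (trans
      (sum-permute (λ k → w (ρ k) * + matchedOfColour c M k) σ)
      (sum-cong-≗ λ j → cong (λ i → w i * matched M j) (inverseˡ σ {j}))))

    matched-total : ∀ M → + 2 * (matched M 0F + (matched M 1F + matched M 2F)) ≡ + N
    matched-total M = trans (cong (_*_ (+ 2)) (eq (matched M 0F) (matched M 1F) (matched M 2F)))
      (trans (sym (matched-weight-σ M (λ _ → 1ℤ))) (trans (sum-const N 1ℤ) (ℤP.*-identityʳ (+ N))))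
      where
      eq : ∀ a b d → a + (b + d) ≡ 1ℤ * a + (1ℤ * b + (1ℤ * d + 0ℤ))
      eq = solve-∀

    gap : PerfectMatching N → (Fin 3 → ℤ) → ℤ
    gap M w = sum (λ j → w j * matched M j)

    -- Both new edges run over all ordered pairs of distinct vertices, since `p` permutes the
    -- vertices, and so cancel by `edge-weight`. The matching edge at a given vertex is subtracted
    -- in the `2(N - 1)` off-diagonal pairs containing that vertex, and every matching edge has two
    -- ends.
    total-exchange : ∀ M w → sum w ≡ 0ℤ → sum₂ (λ u x → exchange w (quad M u x)) ≡ - (+ 4 * (+ N - 1ℤ) * gap M w)
    total-exchange M w w-sum = begin
      sum₂ (λ u x → exchange w (quad M u x))
        ≡⟨ sum₂-cong pointwise ⟩
      -- Only the diagonal needs a correction. The pairs with `x` equal to `p u` remain: there the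
      -- edge created is the edge removed, and keeping them makes the `G` sums range over all edges.
      sum₂ (λ u x → G u x + (G (p u) (p x) + (-1ℤ * (h u + h x) + ⟦ x ≟ u ⟧ * (h u + h x))))
        ≡⟨ trans (sum₂-+ G _) (cong (_+_ (sum₂ G)) (trans (sum₂-+ (λ u x → G (p u) (p x)) _)
             (cong (_+_ (sum₂ λ u x → G (p u) (p x))) (sum₂-+ (λ u x → -1ℤ * (h u + h x)) _)))) ⟩
      sum₂ G + (sum₂ (λ u x → G (p u) (p x)) +
        (sum₂ (λ u x → -1ℤ * (h u + h x)) + sum₂ (λ u x → ⟦ x ≟ u ⟧ * (h u + h x))))
        ≡⟨ cong₂ _+_ G-zero (cong₂ _+_ (trans G-reindex G-zero) (cong₂ _+_ all-pairs diagonal)) ⟩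
      0ℤ + (0ℤ + (-1ℤ * (+ N * S + + N * S) + (S + S)))
        ≡⟨ cong (λ s → 0ℤ + (0ℤ + (-1ℤ * (+ N * s + + N * s) + (s + s)))) (matched-weight-σ M w) ⟩
      0ℤ + (0ℤ + (-1ℤ * (+ N * (+ 2 * g) + + N * (+ 2 * g)) + (+ 2 * g + + 2 * g)))
        ≡⟨ collect (+ N) g ⟩
      - (+ 4 * (+ N - 1ℤ) * g) ∎
      where
      open ≡-Reasoning
      p = partner M
      g = gap M w
      v : Fin N → Fin N → ℤ
      v u x = w (ρ (col c u x))
      h : Fin N → ℤ
      h t = v t (p t)
      S = sum h
      G : Fin N → Fin N → ℤ
      G u x = distinct u x * v u x
      collect : ∀ n g → 0ℤ + (0ℤ + (-1ℤ * (n * (+ 2 * g) + n * (+ 2 * g)) + (+ 2 * g + + 2 * g))) ≡ - (+ 4 * (n - 1ℤ) * g)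
      collect = solve-∀
      G-zero : sum₂ G ≡ 0ℤ
      G-zero = edge-weight balanced (w ∘ ρ) (trans (sym (sum-permute w (Perm.flip σ))) w-sum)
      G-reindex : sum₂ (λ u x → G (p u) (p x)) ≡ sum₂ G
      G-reindex = trans (sum-cong-≗ λ u → reindex M (G (p u))) (reindex M (λ u → sum (G u)))
      all-pairs : sum₂ (λ u x → -1ℤ * (h u + h x)) ≡ -1ℤ * (+ N * S + + N * S)
      all-pairs = trans (sum₂-scale -1ℤ (λ u x → h u + h x)) (cong (_*_ -1ℤ)
        (trans (sum₂-+ {N} {N} (λ u _ → h u) (λ _ x → h x)) (cong₂ _+_ (sum₂-left {N} {N} h) (sum₂-right {N} {N} h))))
      diagonal : sum₂ (λ u x → ⟦ x ≟ u ⟧ * (h u + h x)) ≡ S + S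
      diagonal = trans (sum-cong-≗ λ u → sum-select u (λ x → h u + h x)) (∑-distrib-+ h h)
      off : ∀ a b e f → a + b - (e + f) ≡ (1ℤ - 0ℤ) * a + ((1ℤ - 0ℤ) * b + (-1ℤ * (e + f) + 0ℤ * (e + f)))
      off = solve-∀
      on : ∀ z a b e → z + z - (z + z) ≡ (1ℤ - 1ℤ) * a + ((1ℤ - 1ℤ) * b + (-1ℤ * (e + e) + 1ℤ * (e + e)))
      on = solve-∀
      pointwise : ∀ u x → exchange w (quad M u x) ≡ G u x + (G (p u) (p x) + (-1ℤ * (h u + h x) + ⟦ x ≟ u ⟧ * (h u + h x)))
      pointwise u x with u ≟ x
      ... | yes refl rewrite ⟦⟧-yes (u ≟ u) refl | ⟦⟧-yes (p u ≟ p u) refl =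
        on (w 0F) (v u u) (v (p u) (p u)) (h u)
      ... | no u≢x rewrite ⟦⟧-no (x ≟ u) (u≢x ∘ sym)
                         | ⟦⟧-no (p u ≟ p x) (λ e → u≢x (trans (sym (involutive M u)) (trans (cong p e) (involutive M x)))) =
        off (v u x) (v (p u) (p x)) (h u) (h x)

    module _ (M : PerfectMatching N) {u x : Fin N} (u≢x : u ≢ x) (x≢pu : x ≢ partner M u) where
      open Switch M u≢x x≢pu

      exchange-quad : ∀ w → exchange w (quad M u x) ≡ change c (w ∘ ρ)
      exchange-quad w with u ≟ x
      ... | yes e = ⊥-elim (u≢x e)
      ... | no _  = refl

      switch-gap : ∀ w → gap switch w ≡ gap M w + exchange w (quad M u x)
      switch-gap w = ℤP.*-cancelˡ-≡ (+ 2) (gap switch w) _ (begin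
        + 2 * gap switch w
          ≡⟨ matched-weight-σ switch w ⟨
        sum (λ t → w (ρ (col c t (partner switch t))))
          ≡⟨ switch-weight c (w ∘ ρ) ⟩
        sum (λ t → w (ρ (col c t (partner M t)))) + + 2 * change c (w ∘ ρ)
          ≡⟨ cong₂ _+_ (matched-weight-σ M w) (cong (_*_ (+ 2)) (sym (exchange-quad w))) ⟩
        + 2 * gap M w + + 2 * exchange w (quad M u x)
          ≡⟨ ℤP.*-distribˡ-+ (+ 2) (gap M w) _ ⟨
        + 2 * (gap M w + exchange w (quad M u x)) ∎)
        where open ≡-Reasoning

    degenerate : ∀ M u x w → u ≡ x ⊎ u ≡ partner M x → exchange w (quad M u x) ≡ 0ℤ
    degenerate M u x w e with u ≟ x
    ... | yes _ = cancel (w 0F)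
      where
      cancel : ∀ z → z + z - (z + z) ≡ 0ℤ
      cancel = solve-∀
    degenerate M u x w (inj₁ e) | no u≢x = ⊥-elim (u≢x e)
    degenerate M u x w (inj₂ refl) | no _ rewrite involutive M x =
      cancel (w (ρ (col c (partner M x) x))) (w (ρ (col c x (partner M x))))
      where
      cancel : ∀ a b → a + b - (a + b) ≡ 0ℤ
      cancel = solve-∀

  not-improving-origin : ∀ {x y p q} → p ≡ 0ℤ → q ≡ 0ℤ → ¬ Improves x y p q
  not-improving-origin refl refl i = ℤP.<-irrefl refl (Improves.sum<x+y i)

  -- Improving a matching by one or two switches

  module Improvement {N : ℕ} (c : EdgeColouring N) (balanced : ∀ k l → colourClassSize c k ≡ colourClassSize c l)
                     (σ : Permutation 3 3) (M : PerfectMatching N) where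

    open Exchange c balanced σ
    open EdgeClasses M

    x y : ℤ
    x = gap M gain₁
    y = gap M gain₂

    s₁ s₂ : Fin N → Fin N → ℤ
    s₁ u v = step₁ (quad M u v)
    s₂ u v = step₂ (quad M u v)

    Reaches : ℤ → ℤ → PerfectMatching N → Set
    Reaches p q M′ = gap M′ gain₁ ≡ x + p × gap M′ gain₂ ≡ y + q

    switched : ∀ {u v} → κ u ≢ κ v → ∃ λ M′ → Reaches (s₁ u v) (s₂ u v) M′
    switched {u} {v} κu≢κv = switch , switch-gap M u≢v v≢pu gain₁ , switch-gap M u≢v v≢pu gain₂
      where
      u≢v = λ e → κu≢κv (cong κ e)
      v≢pu = λ e → κu≢κv (sym (trans (cong κ e) (κ-partner u)))
      open Switch M u≢v v≢pu

    degenerate-step : ∀ u v → κ u ≡ κ v → s₁ u v ≡ 0ℤ × s₂ u v ≡ 0ℤ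
    degenerate-step u v e = degenerate M u v gain₁ (κ-same e) , degenerate M u v gain₂ (κ-same e)

    Better : Set
    Better = ∃₂ λ p q → Improves x y p q × ∃ (Reaches p q)

    better-by-switch : ∀ u v → Improves x y (s₁ u v) (s₂ u v) → Better
    better-by-switch u v i = _ , _ , i , switched λ e →
      let z₁ , z₂ = degenerate-step u v e in not-improving-origin z₁ z₂ i

    total-step₁ : sum₂ s₁ ≡ - (+ 4 * (+ N - 1ℤ) * x)
    total-step₁ = total-exchange M gain₁ refl

    total-step₂ : sum₂ s₂ ≡ - (+ 4 * (+ N - 1ℤ) * y)
    total-step₂ = total-exchange M gain₂ refl

    Wide : Set
    Wide = (+ 3 ≤ x × 0ℤ ≤ y) ⊎ (0ℤ ≤ x × + 3 ≤ y) ⊎ (+ 2 ≤ x × + 2 ≤ y)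

    module _ (N≥11 : 11 ℕ.≤ N) where
      open Disjoint (partner M) κ κ-fibre κ-fibre-size N≥11 using (Meet; Meet?)

      -- The first switch does not touch the partners of `u′` and `v′`, so the second step, although
      -- computed in `M`, is still correct in the switched matching. A degenerate pair has step zero
      -- and reduces the claim to a single switch.
      better-by-two-switches : ∀ u v u′ v′ → ¬ Meet (κ u) (κ v) (κ u′) (κ v′) →
                               Improves x y (s₁ u v + s₁ u′ v′) (s₂ u v + s₂ u′ v′) → Better
      better-by-two-switches u v u′ v′ apart i with κ u ≟ κ v | κ u′ ≟ κ v′
      ... | yes e | yes e′ = ⊥-elim (not-improving-origin
                               (cong₂ _+_ (proj₁ (degenerate-step u v e)) (proj₁ (degenerate-step u′ v′ e′)))
                               (cong₂ _+_ (proj₂ (degenerate-step u v e)) (proj₂ (degenerate-step u′ v′ e′))) i)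
      ... | yes e | no _ = better-by-switch u′ v′ (subst₂ (Improves x y)
                               (trans (cong (_+ s₁ u′ v′) (proj₁ (degenerate-step u v e))) (ℤP.+-identityˡ _))
                               (trans (cong (_+ s₂ u′ v′) (proj₂ (degenerate-step u v e))) (ℤP.+-identityˡ _)) i)
      ... | no _ | yes e′ = better-by-switch u v (subst₂ (Improves x y)
                               (trans (cong (_+_ (s₁ u v)) (proj₁ (degenerate-step u′ v′ e′))) (ℤP.+-identityʳ _))
                               (trans (cong (_+_ (s₂ u v)) (proj₂ (degenerate-step u′ v′ e′))) (ℤP.+-identityʳ _)) i)
      ... | no κu≢κv | no κu′≢κv′ = _ , _ , i , switch₂ , reach gain₁ , reach gain₂
        where
        u≢v = λ e → κu≢κv (cong κ e)
        v≢pu = λ e → κu≢κv (sym (trans (cong κ e) (κ-partner u)))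
        open Switch M u≢v v≢pu using (switch-other) renaming (switch to switch₁)
        untouched : ∀ t → κ u ≢ κ t → κ v ≢ κ t → partner switch₁ t ≡ partner M t
        untouched t nu nv = switch-other
          (λ e → nu (sym (cong κ e))) (λ e → nu (sym (trans (cong κ e) (κ-partner u))))
          (λ e → nv (sym (cong κ e))) (λ e → nv (sym (trans (cong κ e) (κ-partner v))))
        keeps-u′ : partner switch₁ u′ ≡ partner M u′
        keeps-u′ = untouched u′ (apart ∘ inj₁ ∘ inj₁) (apart ∘ inj₂ ∘ inj₁)
        keeps-v′ : partner switch₁ v′ ≡ partner M v′
        keeps-v′ = untouched v′ (apart ∘ inj₁ ∘ inj₂) (apart ∘ inj₂ ∘ inj₂)
        u′≢v′ = λ e → κu′≢κv′ (cong κ e)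
        v′≢pu′ = λ e → κu′≢κv′ (sym (trans (cong κ (trans e keeps-u′)) (κ-partner u′)))
        open Switch switch₁ u′≢v′ v′≢pu′ using () renaming (switch to switch₂)
        reach : ∀ w → gap switch₂ w ≡ gap M w + (exchange w (quad M u v) + exchange w (quad M u′ v′))
        reach w = trans (switch-gap switch₁ u′≢v′ v′≢pu′ w)
          (trans (cong₂ _+_ (switch-gap M u≢v v≢pu w) (cong (exchange w) (quad-cong {switch₁} {M} keeps-u′ keeps-v′)))
                 (ℤP.+-assoc (gap M w) _ _))

      improve : Wide → Better
      improve wide with any? (λ u → any? λ v → improves? x y (s₁ u v) (s₂ u v))
      ... | yes (u , v , i) = better-by-switch u v i
      ... | no stuck₁ with any? (λ u → any? λ v → any? λ u′ → any? λ v′ →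
                             ¬? (Meet? (κ u) (κ v) (κ u′) (κ v′)) ×-dec
                             improves? x y (s₁ u v + s₁ u′ v′) (s₂ u v + s₂ u′ v′))
      ...   | yes (u , v , u′ , v′ , apart , i) = better-by-two-switches u v u′ v′ apart i
      ...   | no stuck₂ = ⊥-elim (impossible wide)
        where
        open Deadlock (partner M) κ κ-fibre κ-fibre-size N≥11 (quad M) degenerate-step x y total-step₁ total-step₂
          (λ u v i → stuck₁ (u , v , i)) (λ u v u′ v′ apart i → stuck₂ (u , v , u′ , v′ , apart , i))
        impossible : ¬ Wide
        impossible (inj₁ (hx , hy)) = no-wide-gap₁ hx hy
        impossible (inj₂ (inj₁ (hx , hy))) = no-wide-gap₂ hx hy
        impossible (inj₂ (inj₂ (hx , hy))) = no-wide-gaps hx hy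

    gap₁-difference : ∀ M′ → gap M′ gain₁ ≡ matched M′ 0F - matched M′ 1F
    gap₁-difference M′ = eq (matched M′ 0F) (matched M′ 1F) (matched M′ 2F)
      where
      eq : ∀ a b d → 1ℤ * a + (-1ℤ * b + (0ℤ * d + 0ℤ)) ≡ a - b
      eq = solve-∀

    gap₂-difference : ∀ M′ → gap M′ gain₂ ≡ matched M′ 1F - matched M′ 2F
    gap₂-difference M′ = eq (matched M′ 0F) (matched M′ 1F) (matched M′ 2F)
      where
      eq : ∀ a b d → 0ℤ * a + (1ℤ * b + (-1ℤ * d + 0ℤ)) ≡ b - d
      eq = solve-∀

    -- With three matching edges there are no disjoint switches. The steps (0 , -3) and (-3 , 3), which
    -- the single-switch check leaves open, would make a colour count negative.
    improve-monochromatic : (∀ M′ → matched M′ 0F + (matched M′ 1F + matched M′ 2F) ≡ + 3) →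
                            0ℤ < + 4 * (+ N - 1ℤ) → x ≡ + 3 → y ≡ 0ℤ → Better
    improve-monochromatic three 0<K x≡3 y≡0 with any? (λ u → any? λ v → improves? x y (s₁ u v) (s₂ u v))
    ... | yes (u , v , i) = better-by-switch u v i
    -- At gaps `(3 , 0)` the total height for this form is `6 * 4(N - 1) > 0`, so some pair has
    -- positive height.
    ... | no stuck with any? (λ u → any? λ v → 0ℤ <? height 2 1 (s₁ u v) (s₂ u v))
    ...   | no none = ⊥-elim (ℤP.<⇒≱ positive (ℤP.≤-trans (sum₂-mono λ u v → ℤP.≮⇒≥ λ h → none (u , v , h))
                                                         (ℤP.≤-reflexive (sum₂-zero {N} {N}))))
      where
      open Moves (quad M) x y (+ 4 * (+ N - 1ℤ)) (ℤP.<⇒≤ 0<K) total-step₁ total-step₂ (λ u v i → stuck (u , v , i))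
      positive : 0ℤ < sum₂ (height-at 2 1)
      positive = subst (0ℤ <_) (sym (trans (total-height 2 1) (cong₂ (λ s t → + 4 * (+ N - 1ℤ) * (+ 2 * s + 1ℤ * t)) x≡3 y≡0)))
        (subst (_< + 4 * (+ N - 1ℤ) * + 6) (ℤP.*-zeroˡ (+ 6)) (ℤP.*-monoʳ-<-pos (+ 6) 0<K))
    ...   | yes (u , v , h) = ⊥-elim (contradictory (from-yes (every-quad? λ s → Check.stuck? (+ 3) 0ℤ s →-dec
              ((0ℤ <? height 2 1 (step₁ s) (step₂ s)) →-dec
               (((step₁ s ℤ.≟ 0ℤ) ×-dec (step₂ s ℤ.≟ - + 3)) ⊎-dec ((step₁ s ℤ.≟ - + 3) ×-dec (step₂ s ℤ.≟ + 3)))))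
              (quad M u v) (λ i → stuck (u , v , subst₂ (λ a b → Improves a b (s₁ u v) (s₂ u v)) (sym x≡3) (sym y≡0) i)) h))
      where
      κu≢κv : κ u ≢ κ v
      κu≢κv e = ℤP.<-irrefl refl (subst (0ℤ <_) (cong₂ (height 2 1) (proj₁ (degenerate-step u v e)) (proj₂ (degenerate-step u v e))) h)
      M′ = proj₁ (switched κu≢κv)
      gap₁′ : matched M′ 0F - matched M′ 1F ≡ + 3 + s₁ u v
      gap₁′ = trans (sym (gap₁-difference M′)) (trans (proj₁ (proj₂ (switched κu≢κv))) (cong (_+ s₁ u v) x≡3))
      gap₂′ : matched M′ 1F - matched M′ 2F ≡ 0ℤ + s₂ u v
      gap₂′ = trans (sym (gap₂-difference M′)) (trans (proj₂ (proj₂ (switched κu≢κv))) (cong (_+ s₂ u v) y≡0))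
      negative : ∀ {k} → 0ℤ ≤ matched M′ k → ¬ + 3 * matched M′ k ≡ - + 3
      negative {k} 0≤m e with subst (0ℤ ≤_) e (ℤP.*-monoˡ-≤-nonNeg (+ 3) 0≤m)
      ... | ()
      solve-middle : ∀ a b d → + 3 * b ≡ (a + (b + d)) - (a - b) + (b - d)
      solve-middle = solve-∀
      solve-last : ∀ a b d → + 3 * d ≡ (a + (b + d)) - (a - b) - + 2 * (b - d)
      solve-last = solve-∀
      contradictory : ¬ ((s₁ u v ≡ 0ℤ × s₂ u v ≡ - + 3) ⊎ (s₁ u v ≡ - + 3 × s₂ u v ≡ + 3))
      contradictory (inj₁ (e₁ , e₂)) = negative {1F} (+≤+ z≤n) (trans
        (solve-middle (matched M′ 0F) (matched M′ 1F) (matched M′ 2F))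
        (cong₂ _+_ (cong₂ _-_ (three M′) (trans gap₁′ (cong (_+_ (+ 3)) e₁))) (trans gap₂′ (cong (_+_ 0ℤ) e₂))))
      contradictory (inj₂ (e₁ , e₂)) = negative {2F} (+≤+ z≤n) (trans
        (solve-last (matched M′ 0F) (matched M′ 1F) (matched M′ 2F))
        (cong₂ _-_ (cong₂ _-_ (three M′) (trans gap₁′ (cong (_+_ (+ 3)) e₁)))
                   (cong (_*_ (+ 2)) (trans gap₂′ (cong (_+_ 0ℤ) e₂)))))

  -- Sorted counts and the arithmetic of their gaps

  sort₃ : ∀ (m : Fin 3 → ℕ) → ∃ λ (σ : Permutation 3 3) → m (σ ⟨$⟩ʳ 2F) ℕ.≤ m (σ ⟨$⟩ʳ 1F) × m (σ ⟨$⟩ʳ 1F) ℕ.≤ m (σ ⟨$⟩ʳ 0F)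
  sort₃ m with ℕP.≤-total (m 1F) (m 0F) | ℕP.≤-total (m 2F) (m 1F) | ℕP.≤-total (m 2F) (m 0F)
  ... | inj₁ h₁₀ | inj₁ h₂₁ | _        = Perm.id , h₂₁ , h₁₀
  ... | inj₁ h₁₀ | inj₂ h₁₂ | inj₁ h₂₀ = Perm.transpose 1F 2F , h₁₂ , h₂₀
  ... | inj₁ h₁₀ | inj₂ h₁₂ | inj₂ h₀₂ = Perm.transpose 0F 1F Perm.∘ₚ Perm.transpose 1F 2F , h₁₀ , h₀₂
  ... | inj₂ h₀₁ | inj₁ h₂₁ | inj₁ h₂₀ = Perm.transpose 0F 1F , h₂₀ , h₀₁
  ... | inj₂ h₀₁ | inj₁ h₂₁ | inj₂ h₀₂ = Perm.transpose 1F 2F Perm.∘ₚ Perm.transpose 0F 1F , h₀₂ , h₂₁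
  ... | inj₂ h₀₁ | inj₂ h₁₂ | _        = Perm.transpose 0F 2F , h₀₁ , h₁₂

  3*-residue : ∀ {k n} r → 3 ℕ.* k ℕ.+ r ≡ 3 ℕ.* n → 3 ∣ r
  3*-residue {k} {n} r e = ∣m+n∣m⇒∣n (subst (3 ∣_) (sym e) (m∣m*n n)) (m∣m*n k)

  distance-one : ∀ k → ℕ.∣ k - suc k ∣ ≡ 1
  distance-one k = trans (cong (λ l → ℕ.∣ k - l ∣) (ℕP.+-comm 1 k)) (ℕP.∣m-m+n∣≡n k 1)

  -- The equation forces `a` and `b` to agree modulo 3, which leaves the gaps `(0 , 0)` and
  -- `(1 , 1)`: the counts are all `ν`, or `ν + 1`, `ν`, `ν - 1`. The trailing `0` matches the
  -- unfolded sum over `Fin 3` in `f-sorted`.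
  narrow-sum : ∀ a b k ν → a ℕ.+ b ℕ.≤ 2 → 3 ℕ.* k ℕ.+ (b ℕ.+ (a ℕ.+ b)) ≡ 3 ℕ.* ν →
               ℕ.∣ a ℕ.+ (b ℕ.+ k) - ν ∣ ℕ.+ (ℕ.∣ b ℕ.+ k - ν ∣ ℕ.+ (ℕ.∣ k - ν ∣ ℕ.+ 0)) ℕ.≤ 2
  narrow-sum 0 0 k ν _ e with ℕP.*-cancelˡ-≡ k ν 3 (trans (sym (ℕP.+-identityʳ (3 ℕ.* k))) e)
  ... | refl rewrite ℕP.∣n-n∣≡0 k = z≤n
  narrow-sum 1 1 k ν _ e with ℕP.*-cancelˡ-≡ (suc k) ν 3 (trans (trans (ℕP.*-suc 3 k) (ℕP.+-comm 3 (3 ℕ.* k))) e)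
  ... | refl rewrite ℕP.∣n-n∣≡0 k | ℕP.∣-∣-comm (suc k) k | distance-one k = ℕP.≤-refl
  narrow-sum 0 1 k ν _ e = ⊥-elim (from-no (3 ∣? 2) (3*-residue {k} {ν} 2 e))
  narrow-sum 0 2 k ν _ e = ⊥-elim (from-no (3 ∣? 4) (3*-residue {k} {ν} 4 e))
  narrow-sum 1 0 k ν _ e = ⊥-elim (from-no (3 ∣? 1) (3*-residue {k} {ν} 1 e))
  narrow-sum 2 0 k ν _ e = ⊥-elim (from-no (3 ∣? 2) (3*-residue {k} {ν} 2 e))
  narrow-sum 0 (suc (suc (suc b))) _ _ (s≤s (s≤s ())) _
  narrow-sum 1 (suc (suc b)) _ _ (s≤s (s≤s ())) _
  narrow-sum 2 (suc b) _ _ (s≤s (s≤s ())) _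
  narrow-sum (suc (suc (suc a))) b _ _ (s≤s (s≤s ())) _

  -- Only `(1 , 2)` and `(2 , 1)` lie outside the three alternatives, and their entries are not
  -- congruent modulo 3.
  wide-gaps : ∀ a b k ν → 3 ℕ.≤ a ℕ.+ b → 3 ℕ.* k ℕ.+ (b ℕ.+ (a ℕ.+ b)) ≡ 3 ℕ.* ν →
                (3 ℕ.≤ a × 0 ℕ.≤ b) ⊎ (0 ℕ.≤ a × 3 ℕ.≤ b) ⊎ (2 ℕ.≤ a × 2 ℕ.≤ b)
  wide-gaps 0 b _ _ 3≤b _ = inj₂ (inj₁ (z≤n , 3≤b))
  wide-gaps 1 0 _ _ (s≤s ()) _
  wide-gaps 1 1 _ _ (s≤s (s≤s ())) _
  wide-gaps 1 2 k ν _ e = ⊥-elim (from-no (3 ∣? 5) (3*-residue {k} {ν} 5 e))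
  wide-gaps 2 0 _ _ (s≤s (s≤s ())) _
  wide-gaps 2 1 k ν _ e = ⊥-elim (from-no (3 ∣? 4) (3*-residue {k} {ν} 4 e))
  wide-gaps 2 2 _ _ _ _ = inj₂ (inj₂ (ℕP.≤-refl , ℕP.≤-refl))
  wide-gaps (suc (suc (suc a))) b _ _ _ _ = inj₁ (s≤s (s≤s (s≤s z≤n)) , z≤n)
  wide-gaps a (suc (suc (suc b))) _ _ _ _ = inj₂ (inj₁ (z≤n , s≤s (s≤s (s≤s z≤n))))

  -- The summand `a + b` already exhausts the total 3, so everything else vanishes.
  monochromatic-triple : ∀ a b k → 3 ℕ.≤ a ℕ.+ b → 3 ℕ.* k ℕ.+ (b ℕ.+ (a ℕ.+ b)) ≡ 3 → a ≡ 3 × b ≡ 0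
  monochromatic-triple a b k 3≤a+b e with ℕP.m≤n⇒∃[o]m+o≡n 3≤a+b
  ... | t , 3+t≡a+b = a≡3 , b≡0
    where
    excess : 3 ℕ.* k ℕ.+ (b ℕ.+ t) ≡ 0
    excess = ℕP.+-cancelˡ-≡ 3 _ 0 (trans (shuffle k b t) (trans (cong (λ s → 3 ℕ.* k ℕ.+ (b ℕ.+ s)) 3+t≡a+b) e))
      where
      shuffle : ∀ k b t → 3 ℕ.+ (3 ℕ.* k ℕ.+ (b ℕ.+ t)) ≡ 3 ℕ.* k ℕ.+ (b ℕ.+ (3 ℕ.+ t))
      shuffle = ℕSolver.solve-∀
    b+t≡0 : b ℕ.+ t ≡ 0
    b+t≡0 = ℕP.m+n≡0⇒n≡0 (3 ℕ.* k) excess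
    b≡0 : b ≡ 0
    b≡0 = ℕP.m+n≡0⇒m≡0 b b+t≡0
    a≡3 : a ≡ 3
    a≡3 = trans (sym (ℕP.+-identityʳ a)) (trans (cong (ℕ._+_ a) (sym b≡0))
      (trans (sym 3+t≡a+b) (cong (ℕ._+_ 3) (ℕP.m+n≡0⇒n≡0 b b+t≡0))))

  <-from-difference : ∀ a b s {d} → a - b ≡ d → 0ℤ < s - d → a < b + s
  <-from-difference a b s refl h = <-via (s - (a - b)) h (eq a b s)
    where
    eq : ∀ a b s → b + s ≡ a + (s - (a - b))
    eq = solve-∀

  -- Descent on the spread of the colour counts

  module Balancing (n : ℕ) (c : EdgeColouring (6 ℕ.* suc n))
                   (balanced : ∀ k l → colourClassSize c k ≡ colourClassSize c l) where

    ν : ℕ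
    ν = suc n

    m : PerfectMatching (6 ℕ.* ν) → Fin 3 → ℕ
    m = matchedOfColour c

    total : ∀ (σ : Permutation 3 3) M → m M (σ ⟨$⟩ʳ 0F) ℕ.+ (m M (σ ⟨$⟩ʳ 1F) ℕ.+ m M (σ ⟨$⟩ʳ 2F)) ≡ 3 ℕ.* ν
    total σ M = ℤP.+-injective (ℤP.*-cancelˡ-≡ (+ 2) _ (+ (3 ℕ.* ν)) (trans (Exchange.matched-total c balanced σ M)
      (trans (cong +_ (ℕP.*-assoc 2 3 ν)) (ℤP.pos-* 2 (3 ℕ.* ν)))))

    deviation : PerfectMatching (6 ℕ.* ν) → Fin 3 → ℕ
    deviation M k = ℕ.∣ m M k - ν ∣

    f-sorted : ∀ (σ : Permutation 3 3) M → f ν c M ≡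
               deviation M (σ ⟨$⟩ʳ 0F) ℕ.+ (deviation M (σ ⟨$⟩ʳ 1F) ℕ.+ (deviation M (σ ⟨$⟩ʳ 2F) ℕ.+ 0))
    f-sorted σ M = trans (ℕP.+-assoc (deviation M 0F) (deviation M 1F) (deviation M 2F))
      (trans (cong (λ d → deviation M 0F ℕ.+ (deviation M 1F ℕ.+ d)) (sym (ℕP.+-identityʳ (deviation M 2F))))
             (ℕSum.sum-permute (deviation M) σ))

    module Sorted (σ : Permutation 3 3) (M : PerfectMatching (6 ℕ.* ν)) {a b : ℕ}
                  (m₁≡ : m M (σ ⟨$⟩ʳ 1F) ≡ b ℕ.+ m M (σ ⟨$⟩ʳ 2F))
                  (m₀≡ : m M (σ ⟨$⟩ʳ 0F) ≡ a ℕ.+ m M (σ ⟨$⟩ʳ 1F)) where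

      open Exchange c balanced σ using (gap; matched)
      open Improvement c balanced σ M

      k : ℕ
      k = m M (σ ⟨$⟩ʳ 2F)

      x≡a : x ≡ + a
      x≡a = trans (gap₁-difference M) (trans (cong (λ i → + i - + m M (σ ⟨$⟩ʳ 1F)) m₀≡) (cancel (+ a) (+ m M (σ ⟨$⟩ʳ 1F))))
        where
        cancel : ∀ a b → a + b - b ≡ a
        cancel = solve-∀

      y≡b : y ≡ + b
      y≡b = trans (gap₂-difference M) (trans (cong (λ i → + i - + k) m₁≡) (cancel (+ b) (+ k)))
        where
        cancel : ∀ a b → a + b - b ≡ a
        cancel = solve-∀

      gap-total : 3 ℕ.* k ℕ.+ (b ℕ.+ (a ℕ.+ b)) ≡ 3 ℕ.* ν
      gap-total = trans (rearranged a b k) (trans (cong₂ ℕ._+_ (sym (trans m₀≡ (cong (ℕ._+_ a) m₁≡))) (cong (ℕ._+ k) (sym m₁≡))) (total σ M))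
        where
        rearranged : ∀ a b k → 3 ℕ.* k ℕ.+ (b ℕ.+ (a ℕ.+ b)) ≡ (a ℕ.+ (b ℕ.+ k)) ℕ.+ ((b ℕ.+ k) ℕ.+ k)
        rearranged = ℕSolver.solve-∀

      narrow : a ℕ.+ b ℕ.≤ 2 → f ν c M ℕ.≤ 2
      narrow a+b≤2 = subst (ℕ._≤ 2)
        (sym (trans (f-sorted σ M) (cong₂ (λ s t → ℕ.∣ s - ν ∣ ℕ.+ (ℕ.∣ t - ν ∣ ℕ.+ (ℕ.∣ k - ν ∣ ℕ.+ 0)))
                                          (trans m₀≡ (cong (ℕ._+_ a) m₁≡)) m₁≡)))
        (narrow-sum a b k ν a+b≤2 gap-total)

      module _ {p q : ℤ} (i : Improves x y p q) (M′ : PerfectMatching (6 ℕ.* ν)) (r : Reaches p q M′) where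
        open Improves i

        private
          A = matched M′ 0F
          B = matched M′ 1F
          C = matched M′ 2F

          A-B : A - B ≡ x + p
          A-B = trans (sym (gap₁-difference M′)) (proj₁ r)
          B-C : B - C ≡ y + q
          B-C = trans (sym (gap₂-difference M′)) (proj₂ r)

        -- `σ` sorts the counts of `M` but perhaps not those of `M′`. Bounding the differences of
        -- all pairs of counts expresses progress independently of any order.
        spread : ∀ j j′ → matched M′ j < matched M′ j′ + (x + y)
        spread = λ
          { 0F 0F → self A
          ; 1F 1F → self B
          ; 2F 2F → self C
          ; 0F 1F → <-from-difference A B (x + y) A-B (subst (0ℤ <_) (eq₁ x y p) x+p<x+y)
          ; 1F 2F → <-from-difference B C (x + y) B-C (subst (0ℤ <_) (eq₂ x y q) y+q<x+y)
          ; 0F 2F → <-from-difference A C (x + y) (trans (chain A B C) (cong₂ _+_ A-B B-C)) (subst (0ℤ <_) (eq₃ x y p q) sum<x+y)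
          ; 1F 0F → <-from-difference B A (x + y) (trans (flip A B) (cong -_ A-B)) (subst (0ℤ <_) (eq₄ (x + p) (x + y)) -x-p<x+y)
          ; 2F 1F → <-from-difference C B (x + y) (trans (flip B C) (cong -_ B-C)) (subst (0ℤ <_) (eq₄ (y + q) (x + y)) -y-q<x+y)
          ; 2F 0F → <-from-difference C A (x + y) (trans (flip A C) (cong -_ (trans (chain A B C) (cong₂ _+_ A-B B-C))))
                                      (subst (0ℤ <_) (eq₄ ((x + p) + (y + q)) (x + y)) -sum<x+y)
          }
          where
          chain : ∀ a b d → a - d ≡ (a - b) + (b - d)
          chain = solve-∀
          flip : ∀ a b → b - a ≡ - (a - b)
          flip = solve-∀
          eq₁ : ∀ x y p → y - p ≡ (x + y) - (x + p)
          eq₁ = solve-∀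
          eq₂ : ∀ x y q → x - q ≡ (x + y) - (y + q)
          eq₂ = solve-∀
          eq₃ : ∀ x y p q → - (p + q) ≡ (x + y) - ((x + p) + (y + q))
          eq₃ = solve-∀
          eq₄ : ∀ d s → d + s ≡ s - - d
          eq₄ = solve-∀
          double : ∀ x y p q → - (p + q) + (((x + p) + (y + q)) + (x + y)) ≡ + 2 * (x + y)
          double = solve-∀
          -- Needed for equal indices; it follows by adding the two opposite bounds on the new sum
          -- of gaps.
          0<x+y : 0ℤ < x + y
          0<x+y = ℤP.*-cancelˡ-<-nonNeg (+ 2) (subst (0ℤ <_) (double x y p q) (ℤP.+-mono-< sum<x+y -sum<x+y))
          self : ∀ a → a < a + (x + y)
          self a = <-via (x + y) 0<x+y refl

        spread-ℕ : ∀ j l → m M′ j ℕ.< m M′ l ℕ.+ (a ℕ.+ b)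
        spread-ℕ j l = ℤP.drop‿+<+ (subst₂ (λ s t → + m M′ s < + m M′ t + + (a ℕ.+ b)) (inverseʳ σ) (inverseʳ σ)
          (subst (λ s → matched M′ (σ ⟨$⟩ˡ j) < matched M′ (σ ⟨$⟩ˡ l) + s) (cong₂ _+_ x≡a y≡b) (spread (σ ⟨$⟩ˡ j) (σ ⟨$⟩ˡ l))))

      Narrower : Set
      Narrower = ∃ λ M′ → ∀ j l → m M′ j ℕ.< m M′ l ℕ.+ (a ℕ.+ b)

      narrower : Better → Narrower
      narrower (p , q , i , M′ , r) = M′ , spread-ℕ i M′ r

      wide : 3 ℕ.≤ a ℕ.+ b → Wide
      wide 3≤a+b = Sum.map at (Sum.map at at) (wide-gaps a b k ν 3≤a+b gap-total)
        where
        at : ∀ {s t} → s ℕ.≤ a × t ℕ.≤ b → + s ≤ x × + t ≤ y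
        at (hx , hy) = subst (+ _ ≤_) (sym x≡a) (+≤+ hx) , subst (+ _ ≤_) (sym y≡b) (+≤+ hy)

  step : ∀ n (c : EdgeColouring (6 ℕ.* suc n)) (balanced : ∀ k l → colourClassSize c k ≡ colourClassSize c l)
         (σ : Permutation 3 3) (M : PerfectMatching (6 ℕ.* suc n)) {a b : ℕ} →
         matchedOfColour c M (σ ⟨$⟩ʳ 1F) ≡ b ℕ.+ matchedOfColour c M (σ ⟨$⟩ʳ 2F) →
         matchedOfColour c M (σ ⟨$⟩ʳ 0F) ≡ a ℕ.+ matchedOfColour c M (σ ⟨$⟩ʳ 1F) →
         3 ℕ.≤ a ℕ.+ b → ∃ λ M′ → ∀ j l → matchedOfColour c M′ j ℕ.< matchedOfColour c M′ l ℕ.+ (a ℕ.+ b)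
  step zero c balanced σ M {a} {b} m₁≡ m₀≡ 3≤a+b = narrower (improve-monochromatic
    (λ M′ → cong +_ (total σ M′)) (+<+ (s≤s z≤n)) (trans x≡a (cong +_ a≡3)) (trans y≡b (cong +_ b≡0)))
    where
    open Balancing zero c balanced
    open Sorted σ M m₁≡ m₀≡
    open Improvement c balanced σ M
    a≡3 : a ≡ 3
    a≡3 = proj₁ (monochromatic-triple a b k 3≤a+b gap-total)
    b≡0 : b ≡ 0
    b≡0 = proj₂ (monochromatic-triple a b k 3≤a+b gap-total)
  step (suc n) c balanced σ M {a} {b} m₁≡ m₀≡ 3≤a+b =
    narrower (improve (ℕP.≤-trans (ℕP.m≤m+n 11 1) (ℕP.*-monoʳ-≤ 6 (s≤s (s≤s z≤n)))) (wide 3≤a+b))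
    where
    open Balancing (suc n) c balanced
    open Sorted σ M m₁≡ m₀≡
    open Improvement c balanced σ M

  -- Recursion on `r`, a bound for the differences of the counts. A step makes all differences
  -- strictly smaller than `a + b ≤ r`, so `r` drops by one, and the counts of the new matching are
  -- sorted afresh.
  balance : ∀ n (c : EdgeColouring (6 ℕ.* suc n)) (balanced : ∀ k l → colourClassSize c k ≡ colourClassSize c l) →
            ∀ r M → (∀ k l → matchedOfColour c M k ℕ.≤ matchedOfColour c M l ℕ.+ r) → ∃ λ M′ → f (suc n) c M′ ℕ.≤ 2
  balance n c balanced r M spread≤r with sort₃ (matchedOfColour c M)
  ... | σ , m₂≤m₁ , m₁≤m₀ = by-width r (ℕP.+-cancelʳ-≤ _ (a ℕ.+ b) r (ℕP.≤-trans
          (ℕP.≤-reflexive (trans (ℕP.+-assoc a b _) (sym (trans m₀≡ (cong (ℕ._+_ a) m₁≡)))))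
          (ℕP.≤-trans (spread≤r _ _) (ℕP.≤-reflexive (ℕP.+-comm _ r))))) (a ℕ.+ b ℕ.≤? 2)
    where
    open Balancing n c balanced
    a b : ℕ
    a = m M (σ ⟨$⟩ʳ 0F) ℕ.∸ m M (σ ⟨$⟩ʳ 1F)
    b = m M (σ ⟨$⟩ʳ 1F) ℕ.∸ m M (σ ⟨$⟩ʳ 2F)
    m₁≡ : m M (σ ⟨$⟩ʳ 1F) ≡ b ℕ.+ m M (σ ⟨$⟩ʳ 2F)
    m₁≡ = sym (ℕP.m∸n+n≡m m₂≤m₁)
    m₀≡ : m M (σ ⟨$⟩ʳ 0F) ≡ a ℕ.+ m M (σ ⟨$⟩ʳ 1F)
    m₀≡ = sym (ℕP.m∸n+n≡m m₁≤m₀)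
    by-width : ∀ r → a ℕ.+ b ℕ.≤ r → Dec (a ℕ.+ b ℕ.≤ 2) → ∃ λ M′ → f (suc n) c M′ ℕ.≤ 2
    by-width r _ (yes a+b≤2) = M , Sorted.narrow σ M m₁≡ m₀≡ a+b≤2
    by-width zero a+b≤0 (no a+b≰2) = ⊥-elim (a+b≰2 (ℕP.≤-trans a+b≤0 z≤n))
    by-width (suc r) a+b≤r (no a+b≰2) with step n c balanced σ M m₁≡ m₀≡ (ℕP.≰⇒> a+b≰2)
    ... | M′ , spread = balance n c balanced r M′ λ k l → ℕP.≤-pred (ℕP.≤-trans (spread k l)
            (ℕP.≤-trans (ℕP.+-monoʳ-≤ (m M′ l) a+b≤r) (ℕP.≤-reflexive (ℕP.+-suc (m M′ l) r))))

  -- An initial perfect matching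

  add-edge : ∀ {N} → PerfectMatching N → PerfectMatching (suc (suc N))
  add-edge M .partner 0F = 1F
  add-edge M .partner 1F = 0F
  add-edge M .partner (Fin.suc (Fin.suc t)) = Fin.suc (Fin.suc (partner M t))
  add-edge M .involutive 0F = refl
  add-edge M .involutive 1F = refl
  add-edge M .involutive (Fin.suc (Fin.suc t)) = cong (Fin.suc ∘ Fin.suc) (involutive M t)
  add-edge M .noFixed (Fin.suc (Fin.suc t)) e = noFixed M t (suc-injective (suc-injective e))

  -- Writing the order as `k ℕ.* 2` lets it unfold by two successors at each step, as `add-edge`
  -- requires.
  some-matching : ∀ k → PerfectMatching (k ℕ.* 2)
  some-matching zero = record { partner = λ () ; involutive = λ () ; noFixed = λ () }
  some-matching (suc k) = add-edge (some-matching k)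

  ≤-sum₃ : ∀ (m : Fin 3 → ℕ) k → m k ℕ.≤ m 0F ℕ.+ (m 1F ℕ.+ m 2F)
  ≤-sum₃ m 0F = ℕP.m≤m+n (m 0F) _
  ≤-sum₃ m 1F = ℕP.≤-trans (ℕP.m≤m+n (m 1F) _) (ℕP.m≤n+m _ (m 0F))
  ≤-sum₃ m 2F = ℕP.≤-trans (ℕP.m≤n+m _ (m 1F)) (ℕP.m≤n+m _ (m 0F))

open import Data.Nat using (_*_; _+_; _≤_; NonZero)
open import Data.Nat.Properties using (≤-trans; m≤n+m)

theorem3 : (n : ℕ) → .{{_ : NonZero n}} → (c : EdgeColouring (6 * n)) →
    (∀ (k l : Fin 3) → colourClassSize c k ≡ colourClassSize c l) →
    Σ (PerfectMatching (6 * n)) (λ M → f n c M ≤ 2)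
theorem3 (suc n) c balanced = balance n c balanced (m 0F + (m 1F + m 2F)) M₀
  λ k l → ≤-trans (≤-sum₃ m k) (m≤n+m _ (m l))
  where
  even : ∀ n → 3 * n * 2 ≡ 6 * n
  even = ℕSolver.solve-∀
  M₀ : PerfectMatching (6 * suc n)
  M₀ = subst PerfectMatching (even (suc n)) (some-matching (3 * suc n))
  m : Fin 3 → ℕ
  m = matchedOfColour c M₀
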